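{- Let $q$ be a prime power and let $P_q(B,C),P'_q(B,C)\in\mathbb F_q[B,C]$ be two optimal determining polynomials for primitive quadratic polynomials over $\mathbb F_q$. Then $$P_q(B,C)\equiv P'_q(B,C)\pmod{\Phi_{q-1}(C)}.$$ Equivalently, they have the same image in the quotient ring $A[B]=\mathbb F_q[B,C]/(\Phi_{q-1}(C))$, where $A=\mathbb F_q[C]/(\Phi_{q-1}(C))$. Consequently, the optimal determining polynomial determines a unique regular function on the affine scheme $\mathcal X=\mathbb A^1_{\mathbb F_q}\times\operatorname{Spec}A=\operatorname{Spec}A[B]$.
   Context: $\Phi_{q-1}(C)\in\mathbb F_q[C]$ is the $(q-1)$-st cyclotomic polynomial in the indeterminate $C$. A primitive element of $\mathbb F_q$ is a generator of $\mathbb F_q^*$. A monic quadratic polynomial over $\mathbb F_q$ is primitive if it is the minimal polynomial over $\mathbb F_q$ of a generator of $\mathbb F_{q^2}^*$. A polynomial $P(B,C)\in\mathbb F_q[B,C]$ is an optimal determining polynomial for primitive quadratic polynomials over $\mathbb F_q$ if for every primitive element $c$ of $\mathbb F_q$, $$P(B,c)=\prod_{b\in\mathcal P_c}(B-b),\qquad \mathcal P_c=\{b\in\mathbb F_q: X^2+bX+c\text{ is primitive over }\mathbb F_q\}.$$ -}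

module Defs where

open import Algebra.Bundles using (CommutativeRing)
import Algebra.Properties.CommutativeSemigroup as CommutativeSemigroupProps
import Algebra.Properties.Ring as RingProps
import Algebra.Properties.Semiring.Divisibility as Divisibility
import Algebra.Properties.Semiring.Exp as Exponentiation
open import Data.Fin.Base using (Fin)
open import Data.List.Base using (List; []; _∷_; map; foldr; filter; upTo)
import Data.List.Membership.Setoid as Membership
import Data.List.Relation.Unary.Unique.Setoid as UniqueSetoid
open import Data.Nat.Base as ℕ using (ℕ; zero; suc; _∸_)
open import Data.Nat.Divisibility using (_∣?_)
open import Data.Nat.Primality using (Prime)
open import Data.Product using (∃-syntax; Σ-syntax; _×_; _,_)
open import Data.Sum.Base using (_⊎_)
open import Function.Bundles using (Inverse; _⇔_)
open import Level using (_⊔_) renaming (suc to lsuc)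
open import Relation.Binary.Bundles using (Setoid)
open import Relation.Binary.PropositionalEquality as ≡ using (_≡_)
import Relation.Binary.Reasoning.Setoid as ≈-Reasoning
open import Relation.Binary.Structures using (IsEquivalence)
open import Relation.Nullary.Negation using (¬_)

-- Univariate polynomials over R: lists of coefficients, constant term first.
-- Lists differing only by trailing zeros denote the same polynomial, so
-- equality is equality of all coefficients.

module Polynomial {c ℓ} (R : CommutativeRing c ℓ) where

  open CommutativeRing R

  Poly : Set c
  Poly = List Carrier

  coeff : Poly → ℕ → Carrier
  coeff []      _       = 0#
  coeff (a ∷ p) zero    = a
  coeff (a ∷ p) (suc i) = coeff p i

  infix 4 _≋_
  record _≋_ (p q : Poly) : Set ℓ where
    constructor coeffwise
    field at : ∀ i → coeff p i ≈ coeff q i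
  open _≋_ public

  infixl 6 _⊕_
  infixl 7 _⊛_ _·_

  _⊕_ : Poly → Poly → Poly
  []      ⊕ q       = q
  (a ∷ p) ⊕ []      = a ∷ p
  (a ∷ p) ⊕ (b ∷ q) = (a + b) ∷ (p ⊕ q)

  ⊖_ : Poly → Poly
  ⊖ p = map (-_) p

  _·_ : Carrier → Poly → Poly
  a · p = map (a *_) p

  _⊛_ : Poly → Poly → Poly
  []      ⊛ q = []
  (a ∷ p) ⊛ q = (a · q) ⊕ (0# ∷ p ⊛ q)

  constant : Carrier → Poly
  constant a = a ∷ []

  eval : Poly → Carrier → Carrier
  eval []      x = 0#
  eval (a ∷ p) x = a + x * eval p x

  X-_ : Carrier → Poly
  X- a = (- a) ∷ 1# ∷ []

  Monic : Poly → Set ℓ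
  Monic p = ∃[ n ] coeff p n ≈ 1# × (∀ i → n ℕ.< i → coeff p i ≈ 0#)

  ≋-isEquivalence : IsEquivalence _≋_
  ≋-isEquivalence = record
    { refl  = coeffwise λ i → refl
    ; sym   = λ e → coeffwise λ i → sym (at e i)
    ; trans = λ e f → coeffwise λ i → trans (at e i) (at f i)
    }

  ≋-setoid : Setoid c ℓ
  ≋-setoid = record { isEquivalence = ≋-isEquivalence }

  open RingProps ring using (-0#≈0#)

  open IsEquivalence ≋-isEquivalence
    renaming (refl to ≋-refl; sym to ≋-sym; trans to ≋-trans) using ()

  coeff-⊕ : ∀ p q i → coeff (p ⊕ q) i ≈ coeff p i + coeff q i
  coeff-⊕ []      q       i       = sym (+-identityˡ _)
  coeff-⊕ (a ∷ p) []      i       = sym (+-identityʳ _)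
  coeff-⊕ (a ∷ p) (b ∷ q) zero    = refl
  coeff-⊕ (a ∷ p) (b ∷ q) (suc i) = coeff-⊕ p q i

  coeff-⊖ : ∀ p i → coeff (⊖ p) i ≈ - coeff p i
  coeff-⊖ []      i       = sym -0#≈0#
  coeff-⊖ (a ∷ p) zero    = refl
  coeff-⊖ (a ∷ p) (suc i) = coeff-⊖ p i

  coeff-· : ∀ a p i → coeff (a · p) i ≈ a * coeff p i
  coeff-· a []      i       = sym (zeroʳ a)
  coeff-· a (b ∷ p) zero    = refl
  coeff-· a (b ∷ p) (suc i) = coeff-· a p i

  ∷-cong : ∀ {a b p q} → a ≈ b → p ≋ q → (a ∷ p) ≋ (b ∷ q)
  ∷-cong e f = coeffwise λ { zero → e ; (suc i) → at f i }

  0∷[]≋[] : (0# ∷ []) ≋ []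
  0∷[]≋[] = coeffwise λ { zero → refl ; (suc i) → refl }

  ⊕-cong : ∀ {p p′ q q′} → p ≋ p′ → q ≋ q′ → (p ⊕ q) ≋ (p′ ⊕ q′)
  ⊕-cong {p} {p′} {q} {q′} e f = coeffwise λ i →
    trans (coeff-⊕ p q i)
      (trans (+-cong (at e i) (at f i)) (sym (coeff-⊕ p′ q′ i)))

  ⊕-congˡ : ∀ p {q q′} → q ≋ q′ → (p ⊕ q) ≋ (p ⊕ q′)
  ⊕-congˡ p = ⊕-cong {p} ≋-refl

  ⊕-assoc : ∀ p q r → ((p ⊕ q) ⊕ r) ≋ (p ⊕ (q ⊕ r))
  ⊕-assoc p q r = coeffwise λ i → begin
    coeff ((p ⊕ q) ⊕ r) i                 ≈⟨ coeff-⊕ (p ⊕ q) r i ⟩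
    coeff (p ⊕ q) i + coeff r i           ≈⟨ +-congʳ (coeff-⊕ p q i) ⟩
    (coeff p i + coeff q i) + coeff r i   ≈⟨ +-assoc _ _ _ ⟩
    coeff p i + (coeff q i + coeff r i)   ≈⟨ +-congˡ (coeff-⊕ q r i) ⟨
    coeff p i + coeff (q ⊕ r) i           ≈⟨ coeff-⊕ p (q ⊕ r) i ⟨
    coeff (p ⊕ (q ⊕ r)) i                 ∎
    where open ≈-Reasoning setoid

  ⊕-comm : ∀ p q → (p ⊕ q) ≋ (q ⊕ p)
  ⊕-comm p q = coeffwise λ i →
    trans (coeff-⊕ p q i) (trans (+-comm _ _) (sym (coeff-⊕ q p i)))

  ⊕-identityʳ : ∀ p → (p ⊕ []) ≋ p
  ⊕-identityʳ p = ⊕-comm p []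

  ⊕-inverseʳ : ∀ p → (p ⊕ (⊖ p)) ≋ []
  ⊕-inverseʳ p = coeffwise λ i →
    trans (coeff-⊕ p (⊖ p) i)
      (trans (+-congˡ (coeff-⊖ p i)) (-‿inverseʳ _))

  ⊖-cong : ∀ {p q} → p ≋ q → (⊖ p) ≋ (⊖ q)
  ⊖-cong {p} {q} e = coeffwise λ i →
    trans (coeff-⊖ p i) (trans (-‿cong (at e i)) (sym (coeff-⊖ q i)))

  ⊕-interchange : ∀ p q r s → ((p ⊕ q) ⊕ (r ⊕ s)) ≋ ((p ⊕ r) ⊕ (q ⊕ s))
  ⊕-interchange p q r s = begin
    (p ⊕ q) ⊕ (r ⊕ s)   ≈⟨ ⊕-assoc p q (r ⊕ s) ⟩
    p ⊕ (q ⊕ (r ⊕ s))   ≈⟨ ⊕-congˡ p (⊕-assoc q r s) ⟨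
    p ⊕ ((q ⊕ r) ⊕ s)   ≈⟨ ⊕-congˡ p (⊕-cong (⊕-comm q r) ≋-refl) ⟩
    p ⊕ ((r ⊕ q) ⊕ s)   ≈⟨ ⊕-congˡ p (⊕-assoc r q s) ⟩
    p ⊕ (r ⊕ (q ⊕ s))   ≈⟨ ⊕-assoc p r (q ⊕ s) ⟨
    (p ⊕ r) ⊕ (q ⊕ s)   ∎
    where open ≈-Reasoning ≋-setoid

  ·-cong : ∀ {a b p q} → a ≈ b → p ≋ q → (a · p) ≋ (b · q)
  ·-cong {a} {b} {p} {q} e f = coeffwise λ i →
    trans (coeff-· a p i) (trans (*-cong e (at f i)) (sym (coeff-· b q i)))

  ·-zero : ∀ p → (0# · p) ≋ []
  ·-zero p = coeffwise λ i → trans (coeff-· 0# p i) (zeroˡ _)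

  ·-one : ∀ p → (1# · p) ≋ p
  ·-one p = coeffwise λ i → trans (coeff-· 1# p i) (*-identityˡ _)

  ·-distribˡ : ∀ a p q → (a · (p ⊕ q)) ≋ ((a · p) ⊕ (a · q))
  ·-distribˡ a p q = coeffwise λ i → begin
    coeff (a · (p ⊕ q)) i               ≈⟨ coeff-· a (p ⊕ q) i ⟩
    a * coeff (p ⊕ q) i                 ≈⟨ *-congˡ (coeff-⊕ p q i) ⟩
    a * (coeff p i + coeff q i)         ≈⟨ distribˡ a _ _ ⟩
    a * coeff p i + a * coeff q i       ≈⟨ +-cong (coeff-· a p i) (coeff-· a q i) ⟨
    coeff (a · p) i + coeff (a · q) i   ≈⟨ coeff-⊕ (a · p) (a · q) i ⟨
    coeff ((a · p) ⊕ (a · q)) i         ∎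
    where open ≈-Reasoning setoid

  ·-distribʳ : ∀ a b p → ((a + b) · p) ≋ ((a · p) ⊕ (b · p))
  ·-distribʳ a b p = coeffwise λ i → begin
    coeff ((a + b) · p) i               ≈⟨ coeff-· (a + b) p i ⟩
    (a + b) * coeff p i                 ≈⟨ distribʳ _ a b ⟩
    a * coeff p i + b * coeff p i       ≈⟨ +-cong (coeff-· a p i) (coeff-· b p i) ⟨
    coeff (a · p) i + coeff (b · p) i   ≈⟨ coeff-⊕ (a · p) (b · p) i ⟨
    coeff ((a · p) ⊕ (b · p)) i         ∎
    where open ≈-Reasoning setoid

  ·-assoc : ∀ a b p → ((a * b) · p) ≋ (a · (b · p))
  ·-assoc a b p = coeffwise λ i → begin
    coeff ((a * b) · p) i   ≈⟨ coeff-· (a * b) p i ⟩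
    (a * b) * coeff p i     ≈⟨ *-assoc a b _ ⟩
    a * (b * coeff p i)     ≈⟨ *-congˡ (coeff-· b p i) ⟨
    a * coeff (b · p) i     ≈⟨ coeff-· a (b · p) i ⟨
    coeff (a · (b · p)) i   ∎
    where open ≈-Reasoning setoid

  0∷-distrib : ∀ p q → (0# ∷ (p ⊕ q)) ≋ ((0# ∷ p) ⊕ (0# ∷ q))
  0∷-distrib p q = ∷-cong (sym (+-identityˡ 0#)) ≋-refl

  ⊛-distribʳ : ∀ r p q → ((p ⊕ q) ⊛ r) ≋ ((p ⊛ r) ⊕ (q ⊛ r))
  ⊛-distribʳ r []      q       = ≋-refl
  ⊛-distribʳ r (a ∷ p) []      = ≋-sym (⊕-identityʳ _)
  ⊛-distribʳ r (a ∷ p) (b ∷ q) = begin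
    ((a + b) · r) ⊕ (0# ∷ (p ⊕ q) ⊛ r)
      ≈⟨ ⊕-cong (·-distribʳ a b r) (∷-cong refl (⊛-distribʳ r p q)) ⟩
    ((a · r) ⊕ (b · r)) ⊕ (0# ∷ (p ⊛ r ⊕ q ⊛ r))
      ≈⟨ ⊕-congˡ ((a · r) ⊕ (b · r)) (0∷-distrib (p ⊛ r) (q ⊛ r)) ⟩
    ((a · r) ⊕ (b · r)) ⊕ ((0# ∷ p ⊛ r) ⊕ (0# ∷ q ⊛ r))
      ≈⟨ ⊕-interchange (a · r) (b · r) (0# ∷ p ⊛ r) (0# ∷ q ⊛ r) ⟩
    ((a ∷ p) ⊛ r) ⊕ ((b ∷ q) ⊛ r) ∎
    where open ≈-Reasoning ≋-setoid

  ⊛-congˡ : ∀ p {q q′} → q ≋ q′ → (p ⊛ q) ≋ (p ⊛ q′)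
  ⊛-congˡ []      e = ≋-refl
  ⊛-congˡ (a ∷ p) e = ⊕-cong (·-cong refl e) (∷-cong refl (⊛-congˡ p e))

  ⊛-zeroʳ : ∀ p → (p ⊛ []) ≋ []
  ⊛-zeroʳ []      = ≋-refl
  ⊛-zeroʳ (a ∷ p) = ≋-trans (∷-cong refl (⊛-zeroʳ p)) 0∷[]≋[]

  ⊛-∷ : ∀ p b q → (p ⊛ (b ∷ q)) ≋ ((b · p) ⊕ (0# ∷ p ⊛ q))
  ⊛-∷ []      b q = ≋-sym 0∷[]≋[]
  ⊛-∷ (a ∷ p) b q = ∷-cong (+-congʳ (*-comm a b)) (begin
    (a · q) ⊕ (p ⊛ (b ∷ q))            ≈⟨ ⊕-congˡ (a · q) (⊛-∷ p b q) ⟩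
    (a · q) ⊕ ((b · p) ⊕ (0# ∷ p ⊛ q)) ≈⟨ ⊕-assoc (a · q) (b · p) _ ⟨
    ((a · q) ⊕ (b · p)) ⊕ (0# ∷ p ⊛ q) ≈⟨ ⊕-cong (⊕-comm (a · q) (b · p)) ≋-refl ⟩
    ((b · p) ⊕ (a · q)) ⊕ (0# ∷ p ⊛ q) ≈⟨ ⊕-assoc (b · p) (a · q) _ ⟩
    (b · p) ⊕ ((a ∷ p) ⊛ q)            ∎)
    where open ≈-Reasoning ≋-setoid

  ⊛-comm : ∀ p q → (p ⊛ q) ≋ (q ⊛ p)
  ⊛-comm []      q = ≋-sym (⊛-zeroʳ q)
  ⊛-comm (a ∷ p) q = begin
    (a · q) ⊕ (0# ∷ p ⊛ q)   ≈⟨ ⊕-congˡ (a · q) (∷-cong refl (⊛-comm p q)) ⟩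
    (a · q) ⊕ (0# ∷ q ⊛ p)   ≈⟨ ⊛-∷ q a p ⟨
    q ⊛ (a ∷ p)              ∎
    where open ≈-Reasoning ≋-setoid

  ⊛-cong : ∀ {p p′ q q′} → p ≋ p′ → q ≋ q′ → (p ⊛ q) ≋ (p′ ⊛ q′)
  ⊛-cong {p} {p′} {q} {q′} e f = begin
    p ⊛ q     ≈⟨ ⊛-congˡ p f ⟩
    p ⊛ q′    ≈⟨ ⊛-comm p q′ ⟩
    q′ ⊛ p    ≈⟨ ⊛-congˡ q′ e ⟩
    q′ ⊛ p′   ≈⟨ ⊛-comm q′ p′ ⟩
    p′ ⊛ q′   ∎
    where open ≈-Reasoning ≋-setoid

  ·-⊛-assoc : ∀ a p q → ((a · p) ⊛ q) ≋ (a · (p ⊛ q))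
  ·-⊛-assoc a []      q = ≋-refl
  ·-⊛-assoc a (b ∷ p) q = begin
    ((a * b) · q) ⊕ (0# ∷ (a · p) ⊛ q)
      ≈⟨ ⊕-cong (·-assoc a b q) (∷-cong (sym (zeroʳ a)) (·-⊛-assoc a p q)) ⟩
    (a · (b · q)) ⊕ (a · (0# ∷ p ⊛ q))
      ≈⟨ ·-distribˡ a (b · q) (0# ∷ p ⊛ q) ⟨
    a · ((b ∷ p) ⊛ q) ∎
    where open ≈-Reasoning ≋-setoid

  0∷-⊛ : ∀ p q → ((0# ∷ p) ⊛ q) ≋ (0# ∷ p ⊛ q)
  0∷-⊛ p q = ⊕-cong (·-zero q) ≋-refl

  ⊛-assoc : ∀ p q r → ((p ⊛ q) ⊛ r) ≋ (p ⊛ (q ⊛ r))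
  ⊛-assoc []      q r = ≋-refl
  ⊛-assoc (a ∷ p) q r = begin
    ((a · q) ⊕ (0# ∷ p ⊛ q)) ⊛ r
      ≈⟨ ⊛-distribʳ r (a · q) (0# ∷ p ⊛ q) ⟩
    ((a · q) ⊛ r) ⊕ ((0# ∷ p ⊛ q) ⊛ r)
      ≈⟨ ⊕-cong (·-⊛-assoc a q r) (0∷-⊛ (p ⊛ q) r) ⟩
    (a · (q ⊛ r)) ⊕ (0# ∷ (p ⊛ q) ⊛ r)
      ≈⟨ ⊕-congˡ (a · (q ⊛ r)) (∷-cong refl (⊛-assoc p q r)) ⟩
    (a ∷ p) ⊛ (q ⊛ r) ∎
    where open ≈-Reasoning ≋-setoid

  ⊛-identityˡ : ∀ p → ((1# ∷ []) ⊛ p) ≋ p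
  ⊛-identityˡ p = begin
    (1# · p) ⊕ (0# ∷ [])   ≈⟨ ⊕-cong (·-one p) 0∷[]≋[] ⟩
    p ⊕ []                 ≈⟨ ⊕-identityʳ p ⟩
    p                      ∎
    where open ≈-Reasoning ≋-setoid

  polynomialRing : CommutativeRing c ℓ
  polynomialRing = record
    { Carrier = Poly
    ; _≈_     = _≋_
    ; _+_     = _⊕_
    ; _*_     = _⊛_
    ; -_      = ⊖_
    ; 0#      = []
    ; 1#      = 1# ∷ []
    ; isCommutativeRing = record
      { isRing = record
        { +-isAbelianGroup = record
          { isGroup = record
            { isMonoid = record
              { isSemigroup = record
                { isMagma = record
                  { isEquivalence = ≋-isEquivalence
                  ; ∙-cong        = ⊕-cong
                  }
                ; assoc = ⊕-assoc
                }
              ; identity = (λ p → ≋-refl) , ⊕-identityʳ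
              }
            ; inverse = (λ p → ≋-trans (⊕-comm (⊖ p) p) (⊕-inverseʳ p)) , ⊕-inverseʳ
            ; ⁻¹-cong = ⊖-cong
            }
          ; comm = ⊕-comm
          }
        ; *-cong     = ⊛-cong
        ; *-assoc    = ⊛-assoc
        ; *-identity = ⊛-identityˡ
                     , (λ p → ≋-trans (⊛-comm p (1# ∷ [])) (⊛-identityˡ p))
        ; distrib    = (λ r p q → ≋-trans (⊛-comm r (p ⊕ q))
                          (≋-trans (⊛-distribʳ r p q)
                            (⊕-cong (⊛-comm p r) (⊛-comm q r))))
                     , ⊛-distribʳ
        }
      ; *-comm = ⊛-comm
      }
    }

_[X] : ∀ {c ℓ} → CommutativeRing c ℓ → CommutativeRing c ℓ
R [X] = Polynomial.polynomialRing R

module _ {c ℓ} (R : CommutativeRing c ℓ) where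

  open CommutativeRing R
  open Divisibility semiring using (_∣_; _,_)

  -- The quotient ring R/(f): the carrier of R, with equality modulo f.

  infixl 8 _/⟨_⟩
  _/⟨_⟩ : Carrier → CommutativeRing c (c ⊔ ℓ)
  _/⟨_⟩ f = record
    { Carrier = Carrier
    ; _≈_     = _≡ᶠ_
    ; _+_     = _+_
    ; _*_     = _*_
    ; -_      = -_
    ; 0#      = 0#
    ; 1#      = 1#
    ; isCommutativeRing = record
      { isRing = record
        { +-isAbelianGroup = record
          { isGroup = record
            { isMonoid = record
              { isSemigroup = record
                { isMagma = record
                  { isEquivalence = record
                    { refl = lift refl ; sym = ≡ᶠ-sym ; trans = ≡ᶠ-trans }
                  ; ∙-cong = ≡ᶠ-+-cong
                  }
                ; assoc = λ x y z → lift (+-assoc x y z)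
                }
              ; identity = (λ x → lift (+-identityˡ x)) , (λ x → lift (+-identityʳ x))
              }
            ; inverse = (λ x → lift (-‿inverseˡ x)) , (λ x → lift (-‿inverseʳ x))
            ; ⁻¹-cong = ≡ᶠ-neg-cong
            }
          ; comm = λ x y → lift (+-comm x y)
          }
        ; *-cong     = ≡ᶠ-*-cong
        ; *-assoc    = λ x y z → lift (*-assoc x y z)
        ; *-identity = (λ x → lift (*-identityˡ x)) , (λ x → lift (*-identityʳ x))
        ; distrib    = (λ x y z → lift (distribˡ x y z)) , (λ x y z → lift (distribʳ x y z))
        }
      ; *-comm = λ x y → lift (*-comm x y)
      }
    }
    where
    open RingProps ring
      using (-‿distribˡ-*; -‿distribʳ-*; ⁻¹-anti-homo‿-; -‿+-comm)
    open CommutativeSemigroupProps +-commutativeSemigroup using (interchange)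
    open ≈-Reasoning setoid

    _≡ᶠ_ : Carrier → Carrier → Set (c ⊔ ℓ)
    x ≡ᶠ y = f ∣ (x - y)

    lift : ∀ {x y} → x ≈ y → x ≡ᶠ y
    lift {x} {y} e = 0# , (begin
      0# * f   ≈⟨ zeroˡ f ⟩
      0#       ≈⟨ -‿inverseʳ y ⟨
      y - y    ≈⟨ +-congʳ e ⟨
      x - y    ∎)

    ≡ᶠ-sym : ∀ {x y} → x ≡ᶠ y → y ≡ᶠ x
    ≡ᶠ-sym {x} {y} (k , e) = - k , (begin
      - k * f     ≈⟨ -‿distribˡ-* k f ⟨
      - (k * f)   ≈⟨ -‿cong e ⟩
      - (x - y)   ≈⟨ ⁻¹-anti-homo‿- x y ⟩
      y - x       ∎)

    ≡ᶠ-trans : ∀ {x y z} → x ≡ᶠ y → y ≡ᶠ z → x ≡ᶠ z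
    ≡ᶠ-trans {x} {y} {z} (k , e) (k′ , e′) = k + k′ , (begin
      (k + k′) * f          ≈⟨ distribʳ f k k′ ⟩
      k * f + k′ * f        ≈⟨ +-cong e e′ ⟩
      (x - y) + (y - z)     ≈⟨ +-assoc x (- y) (y - z) ⟩
      x + (- y + (y - z))   ≈⟨ +-congˡ (+-assoc (- y) y (- z)) ⟨
      x + ((- y + y) - z)   ≈⟨ +-congˡ (+-congʳ (-‿inverseˡ y)) ⟩
      x + (0# - z)          ≈⟨ +-congˡ (+-identityˡ (- z)) ⟩
      x - z                 ∎)

    ≡ᶠ-+-cong : ∀ {x x′ y y′} → x ≡ᶠ x′ → y ≡ᶠ y′ → (x + y) ≡ᶠ (x′ + y′)
    ≡ᶠ-+-cong {x} {x′} {y} {y′} (k , e) (k′ , e′) = k + k′ , (begin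
      (k + k′) * f            ≈⟨ distribʳ f k k′ ⟩
      k * f + k′ * f          ≈⟨ +-cong e e′ ⟩
      (x - x′) + (y - y′)     ≈⟨ interchange x (- x′) y (- y′) ⟩
      (x + y) + (- x′ - y′)   ≈⟨ +-congˡ (-‿+-comm x′ y′) ⟩
      (x + y) - (x′ + y′)     ∎)

    ≡ᶠ-neg-cong : ∀ {x y} → x ≡ᶠ y → (- x) ≡ᶠ (- y)
    ≡ᶠ-neg-cong {x} {y} (k , e) = - k , (begin
      - k * f     ≈⟨ -‿distribˡ-* k f ⟨
      - (k * f)   ≈⟨ -‿cong e ⟩
      - (x - y)   ≈⟨ -‿+-comm x (- y) ⟨
      - x - - y   ∎)

    ≡ᶠ-*-congˡ : ∀ x {y y′} → y ≡ᶠ y′ → (x * y) ≡ᶠ (x * y′)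
    ≡ᶠ-*-congˡ x {y} {y′} (k , e) = x * k , (begin
      x * k * f            ≈⟨ *-assoc x k f ⟩
      x * (k * f)          ≈⟨ *-congˡ e ⟩
      x * (y - y′)         ≈⟨ distribˡ x y (- y′) ⟩
      x * y + x * (- y′)   ≈⟨ +-congˡ (-‿distribʳ-* x y′) ⟨
      x * y - x * y′       ∎)

    ≡ᶠ-*-cong : ∀ {x x′ y y′} → x ≡ᶠ x′ → y ≡ᶠ y′ → (x * y) ≡ᶠ (x′ * y′)
    ≡ᶠ-*-cong {x} {x′} {y} {y′} e e′ =
      ≡ᶠ-trans (≡ᶠ-*-congˡ x e′)
        (≡ᶠ-trans (lift (*-comm x y′))
          (≡ᶠ-trans (≡ᶠ-*-congˡ y′ e) (lift (*-comm y′ x′))))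

-- The affine scheme Spec R, as far as its global regular functions: sections
-- over all of Spec R of the structure sheaf.

module Spec {c ℓ} (R : CommutativeRing c ℓ) where

  open CommutativeRing R

  record PrimeIdeal : Set (lsuc (c ⊔ ℓ)) where
    infix 4 _∈𝔭 _∉𝔭
    field
      _∈𝔭   : Carrier → Set (c ⊔ ℓ)
      resp  : ∀ {x y} → x ≈ y → x ∈𝔭 → y ∈𝔭
      0∈𝔭   : 0# ∈𝔭
      +-∈𝔭  : ∀ {x y} → x ∈𝔭 → y ∈𝔭 → (x + y) ∈𝔭
      *-∈𝔭  : ∀ r {x} → x ∈𝔭 → (r * x) ∈𝔭
      1∉𝔭   : ¬ (1# ∈𝔭)
      prime : ∀ {x y} → (x * y) ∈𝔭 → x ∈𝔭 ⊎ y ∈𝔭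

    _∉𝔭 : Carrier → Set (c ⊔ ℓ)
    x ∉𝔭 = ¬ (x ∈𝔭)

  open PrimeIdeal using (_∉𝔭; 1∉𝔭)

  -- Elements num/den of the local ring R_𝔭.

  record Localization (𝔭 : PrimeIdeal) : Set (c ⊔ ℓ) where
    constructor _/_∶_
    field
      num  : Carrier
      den  : Carrier
      den∉ : _∉𝔭 𝔭 den
  open Localization

  infix 4 _≈ₗ_
  _≈ₗ_ : ∀ {𝔭} → Localization 𝔭 → Localization 𝔭 → Set (c ⊔ ℓ)
  _≈ₗ_ {𝔭} s t = ∃[ u ] (_∉𝔭 𝔭 u × u * (num s * den t) ≈ u * (num t * den s))

  -- Since the sets D(h) = {𝔮 : h ∉ 𝔮} form a base of the Zariski topology,
  -- the neighbourhood on which a section is a single fraction a/g may be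
  -- taken of this form.

  record RegularFunction : Set (lsuc (c ⊔ ℓ)) where
    field
      value   : ∀ 𝔭 → Localization 𝔭
      locally : ∀ 𝔭 → ∃[ h ] ∃[ a ] ∃[ g ] (_∉𝔭 𝔭 h ×
                  (∀ 𝔮 → _∉𝔭 𝔮 h → Σ[ g∉𝔮 ∈ _∉𝔭 𝔮 g ] value 𝔮 ≈ₗ (a / g ∶ g∉𝔮)))
  open RegularFunction

  infix 4 _≈ᵣ_
  _≈ᵣ_ : RegularFunction → RegularFunction → Set (lsuc (c ⊔ ℓ))
  s ≈ᵣ t = ∀ 𝔭 → value s 𝔭 ≈ₗ value t 𝔭

  regular : Carrier → RegularFunction
  regular r = record
    { value   = λ 𝔭 → r / 1# ∶ 1∉𝔭 𝔭
    ; locally = λ 𝔭 → 1# , r , 1# , 1∉𝔭 𝔭 ,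
                  λ 𝔮 1∉𝔮 → 1∉𝔮 , 1# , 1∉𝔮 , refl
    }

IsPrimePower : ℕ → Set
IsPrimePower q = ∃[ p ] ∃[ k ] (Prime p × q ≡ p ℕ.^ suc k)

record FiniteField c ℓ (q : ℕ) : Set (lsuc (c ⊔ ℓ)) where
  field
    commutativeRing : CommutativeRing c ℓ
  open CommutativeRing commutativeRing public
  field
    1≉0         : ¬ (1# ≈ 0#)
    invertible  : ∀ x → ¬ (x ≈ 0#) → ∃[ y ] x * y ≈ 1#
    enumeration : Inverse (≡.setoid (Fin q)) setoid

  open Exponentiation semiring public using (_^_)

  -- Generators of the unit group; as this group is finite, powers with
  -- exponents in ℕ are all the powers.

  IsPrimitiveElement : Carrier → Set (c ⊔ ℓ)
  IsPrimitiveElement g = ¬ (g ≈ 0#) × (∀ a → ¬ (a ≈ 0#) → ∃[ k ] g ^ k ≈ a)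

product : ∀ {c ℓ} (R : CommutativeRing c ℓ) → let open CommutativeRing R in
          List Carrier → Carrier
product R = foldr _*_ 1# where open CommutativeRing R

divisors : ℕ → List ℕ
divisors n = filter (_∣? n) (map suc (upTo n))

-- The cyclotomic polynomials over a field are determined by
-- ∏_{d ∣ n} Φ_d = C^n − 1 for all n ≥ 1; the solution is the reduction of the
-- family over ℤ.

module _ {c ℓ q} (F : FiniteField c ℓ q) where

  private
    F[C] = FiniteField.commutativeRing F [X]
    module F    = FiniteField F
    module F[C] = CommutativeRing F[C]
    open Exponentiation F[C].semiring using (_^_)

    C : F[C].Carrier
    C = F.0# ∷ F.1# ∷ []

  IsCyclotomicFamily : (ℕ → F[C].Carrier) → Set ℓ
  IsCyclotomicFamily Φ = ∀ n → 1 ℕ.≤ n →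
    product F[C] (map Φ (divisors n)) F[C].≈ (C ^ n F[C].- F[C].1#)

  IsCyclotomic : ℕ → F[C].Carrier → Set (c ⊔ ℓ)
  IsCyclotomic n f = ∃[ Φ ] (IsCyclotomicFamily Φ × f F[C].≈ Φ n)

-- F = 𝔽_q, E = 𝔽_{q²}, and ι is meant to be an embedding of fields.

module Quadratic {f ℓ f′ ℓ′ q} (F : FiniteField f ℓ q) (E : FiniteField f′ ℓ′ (q ℕ.^ 2))
                 (ι : FiniteField.Carrier F → FiniteField.Carrier E) where

  private
    module F = FiniteField F
    module E = FiniteField E

  open Polynomial F.commutativeRing using (Poly; Monic; eval; X-_)
  open Polynomial E.commutativeRing using () renaming (eval to evalᴱ)

  -- F[B,C] is taken to be F[C][B]: polynomials in B over polynomials in C.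

  F[C] F[B] F[C][B] : CommutativeRing f ℓ
  F[C]    = F.commutativeRing [X]
  F[B]    = F.commutativeRing [X]
  F[C][B] = F[C] [X]

  module F[C]    = CommutativeRing F[C]
  module F[B]    = CommutativeRing F[B]
  module F[C][B] = CommutativeRing F[C][B]

  IsMinimalPolynomial : Poly → E.Carrier → Set (f ⊔ ℓ ⊔ ℓ′)
  IsMinimalPolynomial m γ =
    Monic m × Annihilates m × (∀ g → Annihilates g → m ∣ g)
    where
    open Divisibility F[C].semiring using (_∣_)
    Annihilates : Poly → Set ℓ′
    Annihilates g = evalᴱ (map ι g) γ E.≈ E.0#

  IsPrimitiveQuadratic : (b c : F.Carrier) → Set (f ⊔ ℓ ⊔ f′ ⊔ ℓ′)
  IsPrimitiveQuadratic b c =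
    ∃[ γ ] (E.IsPrimitiveElement γ × IsMinimalPolynomial (c ∷ b ∷ F.1# ∷ []) γ)

  _at-C≔_ : F[C][B].Carrier → F.Carrier → F[B].Carrier
  P at-C≔ c = map (λ p → eval p c) P

  -- 𝒫_c = {b : X² + bX + c is primitive}, a finite set, enters the product
  -- ∏_{b ∈ 𝒫_c} (B − b) through an enumeration bs without repetition.

  IsEnumerationOf𝒫 : F.Carrier → List F.Carrier → Set (f ⊔ ℓ ⊔ f′ ⊔ ℓ′)
  IsEnumerationOf𝒫 c bs = Unique bs × (∀ b → b ∈ bs ⇔ IsPrimitiveQuadratic b c)
    where
    open Membership F.setoid using (_∈_)
    open UniqueSetoid F.setoid using (Unique)

  IsOptimalDetermining : F[C][B].Carrier → Set (f ⊔ ℓ ⊔ f′ ⊔ ℓ′)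
  IsOptimalDetermining P = ∀ c → F.IsPrimitiveElement c →
    ∃[ bs ] (IsEnumerationOf𝒫 c bs × (P at-C≔ c) F[B].≈ product F[B] (map X-_ bs))

  module Modulo (Φ : F[C].Carrier) where

    A A[B] F[C][B]/Φ : CommutativeRing f (f ⊔ ℓ)
    A         = F[C] /⟨ Φ ⟩
    A[B]      = A [X]
    F[C][B]/Φ = F[C][B] /⟨ Polynomial.constant F[C] Φ ⟩

    module A         = CommutativeRing A
    module A[B]      = CommutativeRing A[B]
    module F[C][B]/Φ = CommutativeRing F[C][B]/Φ

    infix 4 _≡_modΦ
    _≡_modΦ : F[C][B].Carrier → F[C][B].Carrier → Set (f ⊔ ℓ)
    P ≡ P′ modΦ = Polynomial.constant F[C] Φ ∣ (P F[C][B].- P′)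
      where open Divisibility F[C][B].semiring using (_∣_)

    π : F[C].Carrier → A.Carrier
    π a = a

    image : F[C][B].Carrier → A[B].Carrier
    image = map π

    -- 𝒳 = 𝔸¹ × Spec A = Spec (F[B] ⊗ A) = Spec A[B].
    module 𝒳 = Spec A[B]

{-# OPTIONS --safe #-}
-- For primitive c, the polynomials P(B, c) and P′(B, c) are products over two enumerations of
-- the same set, so every coefficient f ∈ F[C] of P − P′ vanishes at the primitive elements.
-- Put n = q − 1 and G = ∏_{d ∣ n, d < n} Φ_d. A non-primitive x ∈ F* satisfies xᵈ = 1 for some
-- proper divisor d of n, hence G(x) = 0. So f G vanishes on F*, that is, Φ_n G = Cⁿ − 1 divides
-- f G, and cancelling G, a divisor of the non-zero-divisor Cⁿ − 1, gives Φ_n ∣ f.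

module Submission where

open import Defs
open import Algebra.Bundles using (CommutativeRing)
open import Algebra.Morphism.Structures using (module RingMorphisms)
import Algebra.Properties.CommutativeSemigroup as CommutativeSemigroupProperties
import Algebra.Properties.Ring as RingProperties
import Algebra.Properties.Semiring.Divisibility as Divisibility
import Algebra.Properties.Semiring.Exp as Exponentiation
open import Data.Fin.Properties as Fin using ()
open import Data.List.Base
  using (List; []; _∷_; _++_; _∷ʳ_; [_]; map; length; replicate; filter; tabulate; upTo; applyUpTo)
open import Data.List.Membership.Propositional using (find; lose) renaming (_∈_ to _∈ℕ_)
import Data.List.Membership.Propositional.Properties as ∈ₚ
import Data.List.Membership.Setoid as Membership
import Data.List.Membership.Setoid.Properties as ∈ₛ
open import Data.List.Properties
  using ( length-++; ++-identityʳ; length-map; length-tabulate; length-applyUpTo; length-replicate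
       ; map-id; map-++; filter-++; filter-accept; upTo-∷ʳ
        )
import Data.List.Relation.Binary.Permutation.Setoid as Permutation
import Data.List.Relation.Binary.Permutation.Setoid.Properties as ↭ₛ
open import Data.List.Relation.Unary.All as All using (All; []; _∷_)
open import Data.List.Relation.Unary.AllPairs using ([]; _∷_)
open import Data.List.Relation.Unary.Any as Any using (here; there)
import Data.List.Relation.Unary.All.Properties as Allₚ
import Data.List.Relation.Unary.Any.Properties as Anyₚ
import Data.List.Relation.Unary.Unique.Setoid as Unique
import Data.List.Relation.Unary.Unique.Setoid.Properties as Uniqueₛ
open import Data.Nat.Base as ℕ using (ℕ; zero; suc; _∸_; z≤n; s≤s)
open import Data.Nat.Divisibility as ∣ℕ using () renaming (_∣_ to _∣ℕ_; _∣?_ to _∣ℕ?_)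
open import Data.Nat.GCD using (gcd; gcd-GCD; gcd[m,n]∣m; gcd[m,n]∣n; gcd[m,n]≡0⇒m≡0; module Bézout)
import Data.Nat.Properties as ℕ
open import Data.Product using (∃-syntax; ∃!; _×_; _,_; proj₁; proj₂)
open import Data.Sum.Base using (_⊎_; inj₁; inj₂)
open import Function.Base using (_∘_; id)
open import Function.Bundles using (Injection; Inverse; Equivalence)
import Function.Properties.Inverse as Inverseₚ
open import Level using (Level; _⊔_)
open import Relation.Binary.Bundles using (Setoid)
open import Relation.Binary.PropositionalEquality as ≡ using (_≡_)
import Relation.Binary.Reasoning.Setoid as ≈-Reasoning
open import Relation.Nullary.Decidable using (Dec; yes; no; ¬?; via-injection)
open import Relation.Nullary.Negation using (¬_; contradiction)

-- Φ_n is given only by the relations ∏_{e ∣ d} Φ_e = C^d - 1, so neither its degree nor its roots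
-- are at hand; multiplying by G leaves C^n - 1 as the only polynomial whose degree and roots have
-- to be known. The same relations explain why x^d = 1 forces G(x) = 0: some Φ_e with e ∣ d vanishes
-- at x, and e is again a proper divisor of n. A non-primitive x has such a d because otherwise 1,
-- x, ..., x^(n-1) would be distinct and fill F*. Polynomials are lists up to trailing zeros and
-- carry no degree. List length takes its place where roots are counted, and C^n - 1 is cancelled by
-- looking at coefficients.

-- Lists without repetition and permutations

module UniqueLists {a ℓ : Level} (S : Setoid a ℓ) where

  open Setoid S
  open Membership S using (_∈_)
  open Permutation S using (_↭_; ↭-refl; ↭-sym; ↭-trans; ↭-prep)
  open Unique S using (Unique)

  private
    ∈-∷⁻ : ∀ {x y ys zs} → All (λ z → ¬ x ≈ z) ys → y ∈ ys → y ∈ x ∷ zs → y ∈ zs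
    ∈-∷⁻ x≉ys y∈ys (here y≈x)   = contradiction (∈ₛ.∈-resp-≈ S y≈x y∈ys) (∈ₛ.All[≉]⇒∉ S x≉ys)
    ∈-∷⁻ _    _    (there y∈zs) = y∈zs

    ++-disjoint : ∀ xs {z zs} → Unique (xs ++ z ∷ zs) → ¬ z ∈ xs
    ++-disjoint xs {z} {zs} uniq z∈xs =
      Uniqueₛ.Unique[x∷xs]⇒x∉xs S
        (↭ₛ.Unique-resp-↭ S (↭ₛ.shift S refl xs zs) uniq) (∈ₛ.∈-++⁺ˡ S z∈xs)

  -- Move an occurrence of the head `x` to the front of `ys`. The other members of `xs` differ from
  -- `x`, so they still occur in what remains and the induction continues; `zs` is what is left at
  -- the end.
  unique-⊆⇒↭-++ : ∀ {xs ys} → Unique xs → (∀ {x} → x ∈ xs → x ∈ ys) →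
                  ∃[ zs ] ys ↭ xs ++ zs
  unique-⊆⇒↭-++ {[]}     {ys} _              _     = ys , ↭-refl
  unique-⊆⇒↭-++ {x ∷ xs} {ys} (x≉xs ∷ uniq) xs⊆ys =
    let as , bs , w , x≈w , ys≋ = ∈ₛ.∈-∃++ S (xs⊆ys (here refl))
        ys↭ = ↭-trans (Permutation.refl ys≋) (↭ₛ.shift S (sym x≈w) as bs)
        zs , as++bs↭ = unique-⊆⇒↭-++ uniq λ y∈xs →
          ∈-∷⁻ x≉xs y∈xs (↭ₛ.∈-resp-↭ S ys↭ (xs⊆ys (there y∈xs)))
    in zs , ↭-trans ys↭ (↭-prep x as++bs↭)

  -- A leftover `z` would lie in `xs` by the reverse inclusion and so occur twice in `ys`.
  unique-⊆-⊇⇒↭ : ∀ {xs ys} → Unique xs → Unique ys →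
                 (∀ {x} → x ∈ xs → x ∈ ys) → (∀ {x} → x ∈ ys → x ∈ xs) → xs ↭ ys
  unique-⊆-⊇⇒↭ {xs} uniq-xs uniq-ys xs⊆ys ys⊆xs with unique-⊆⇒↭-++ uniq-xs xs⊆ys
  ... | []     , ys↭ = ↭-sym (≡.subst (_ ↭_) (++-identityʳ xs) ys↭)
  ... | z ∷ zs , ys↭ = contradiction
    (ys⊆xs (↭ₛ.∈-resp-↭ S (↭-sym ys↭) (∈ₛ.∈-++⁺ʳ S xs (here refl))))
    (++-disjoint xs (↭ₛ.Unique-resp-↭ S ys↭ uniq-ys))

  -- The pigeonhole principle: it turns distinctness into exhaustion, for the multiples and for the
  -- powers of a field element.
  unique-⊆-length⇒↭ : ∀ {xs ys} → Unique xs → (∀ {x} → x ∈ xs → x ∈ ys) →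
                      length ys ≡ length xs → xs ↭ ys
  unique-⊆-length⇒↭ {xs} uniq xs⊆ys len with unique-⊆⇒↭-++ uniq xs⊆ys
  ... | []     , ys↭ = ↭-sym (≡.subst (_ ↭_) (++-identityʳ xs) ys↭)
  ... | z ∷ zs , ys↭ = contradiction
    (≡.trans (≡.sym (≡.trans (↭ₛ.xs↭ys⇒|xs|≡|ys| S ys↭) (length-++ xs))) len)
    (ℕ.m+1+n≢m (length xs))

-- Evaluation, the polynomial X^n - 1 and division by X - a

module PolynomialProperties {c ℓ : Level} (R : CommutativeRing c ℓ) where

  open CommutativeRing R
  open Polynomial R
  open RingProperties ring
  open CommutativeSemigroupProperties +-commutativeSemigroup using (interchange)
  open CommutativeSemigroupProperties *-commutativeSemigroup using (x∙yz≈y∙xz)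
  open Exponentiation semiring using (_^_; ^-congˡ)
  open Divisibility semiring using (_∣_) renaming (_,_ to _∣,_)

  private
    R[X] = R [X]
    module R[X] = CommutativeRing R[X]
    module R[X]ₚ = RingProperties R[X].ring
    open Exponentiation R[X].semiring using () renaming (_^_ to _^ₚ_)
    open Divisibility R[X].semiring using () renaming (_∣_ to _∣ₚ_; _,_ to _∣ₚ,_)

  X : Poly
  X = 0# ∷ 1# ∷ []

  -- A nonempty list of zeros also represents 0; this settles the cases of `eval-cong` where one
  -- list ends before the other.
  eval-≋[] : ∀ {p} → p ≋ [] → ∀ x → eval p x ≈ 0#
  eval-≋[] {[]}    e x = refl
  eval-≋[] {a ∷ p} e x = begin
    a + x * eval p x   ≈⟨ +-cong (at e 0) (*-congˡ (eval-≋[] {p} (coeffwise (at e ∘ suc)) x)) ⟩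
    0# + x * 0#        ≈⟨ +-identityˡ _ ⟩
    x * 0#             ≈⟨ zeroʳ x ⟩
    0#                 ∎
    where open ≈-Reasoning setoid

  eval-cong : ∀ {p q} → p ≋ q → ∀ x → eval p x ≈ eval q x
  eval-cong {[]}    {q}     e x = sym (eval-≋[] (R[X].sym e) x)
  eval-cong {a ∷ p} {[]}    e x = eval-≋[] e x
  eval-cong {a ∷ p} {b ∷ q} e x =
    +-cong (at e 0) (*-congˡ (eval-cong {p} {q} (coeffwise (at e ∘ suc)) x))

  eval-constant : ∀ a x → eval (constant a) x ≈ a
  eval-constant a x = trans (+-congˡ (zeroʳ x)) (+-identityʳ a)

  eval-⊕ : ∀ p q x → eval (p ⊕ q) x ≈ eval p x + eval q x
  eval-⊕ []      q       x = sym (+-identityˡ _)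
  eval-⊕ (a ∷ p) []      x = sym (+-identityʳ _)
  eval-⊕ (a ∷ p) (b ∷ q) x = begin
    (a + b) + x * eval (p ⊕ q) x               ≈⟨ +-congˡ (*-congˡ (eval-⊕ p q x)) ⟩
    (a + b) + x * (eval p x + eval q x)        ≈⟨ +-congˡ (distribˡ x _ _) ⟩
    (a + b) + (x * eval p x + x * eval q x)    ≈⟨ interchange a b _ _ ⟩
    (a + x * eval p x) + (b + x * eval q x)    ∎
    where open ≈-Reasoning setoid

  eval-⊖ : ∀ p x → eval (⊖ p) x ≈ - eval p x
  eval-⊖ []      x = sym -0#≈0#
  eval-⊖ (a ∷ p) x = begin
    - a + x * eval (⊖ p) x   ≈⟨ +-congˡ (*-congˡ (eval-⊖ p x)) ⟩
    - a + x * - eval p x     ≈⟨ +-congˡ (-‿distribʳ-* x _) ⟨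
    - a - x * eval p x       ≈⟨ -‿+-comm a _ ⟩
    - (a + x * eval p x)     ∎
    where open ≈-Reasoning setoid

  eval-· : ∀ a p x → eval (a · p) x ≈ a * eval p x
  eval-· a []      x = sym (zeroʳ a)
  eval-· a (b ∷ p) x = begin
    a * b + x * eval (a · p) x     ≈⟨ +-congˡ (*-congˡ (eval-· a p x)) ⟩
    a * b + x * (a * eval p x)     ≈⟨ +-congˡ (x∙yz≈y∙xz x a _) ⟩
    a * b + a * (x * eval p x)     ≈⟨ distribˡ a b _ ⟨
    a * (b + x * eval p x)         ∎
    where open ≈-Reasoning setoid

  eval-⊛ : ∀ p q x → eval (p ⊛ q) x ≈ eval p x * eval q x
  eval-⊛ []      q x = sym (zeroˡ _)
  eval-⊛ (a ∷ p) q x = begin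
    eval ((a · q) ⊕ (0# ∷ p ⊛ q)) x
      ≈⟨ eval-⊕ (a · q) _ x ⟩
    eval (a · q) x + (0# + x * eval (p ⊛ q) x)
      ≈⟨ +-cong (eval-· a q x) (trans (+-identityˡ _) (*-congˡ (eval-⊛ p q x))) ⟩
    a * eval q x + x * (eval p x * eval q x)
      ≈⟨ +-congˡ (*-assoc x _ _) ⟨
    a * eval q x + (x * eval p x) * eval q x
      ≈⟨ distribʳ _ a _ ⟨
    (a + x * eval p x) * eval q x ∎
    where open ≈-Reasoning setoid

  eval-^ : ∀ p n x → eval (p ^ₚ n) x ≈ eval p x ^ n
  eval-^ p zero    x = eval-constant 1# x
  eval-^ p (suc n) x = trans (eval-⊛ p (p ^ₚ n) x) (*-congˡ (eval-^ p n x))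

  eval-product : ∀ ps x → eval (product R[X] ps) x ≈ product R (map (λ p → eval p x) ps)
  eval-product []       x = eval-constant 1# x
  eval-product (p ∷ ps) x =
    trans (eval-⊛ p (product R[X] ps) x) (*-congˡ (eval-product ps x))

  eval-X : ∀ x → eval X x ≈ x
  eval-X x = begin
    0# + x * (1# + x * 0#)   ≈⟨ +-identityˡ _ ⟩
    x * (1# + x * 0#)        ≈⟨ *-congˡ (eval-constant 1# x) ⟩
    x * 1#                   ≈⟨ *-identityʳ x ⟩
    x                        ∎
    where open ≈-Reasoning setoid

  eval-X- : ∀ a x → eval (X- a) x ≈ x - a
  eval-X- a x = begin
    - a + x * (1# + x * 0#)   ≈⟨ +-comm _ _ ⟩
    x * (1# + x * 0#) - a     ≈⟨ +-congʳ (*-congˡ (eval-constant 1# x)) ⟩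
    x * 1# - a                ≈⟨ +-congʳ (*-identityʳ x) ⟩
    x - a                     ∎
    where open ≈-Reasoning setoid

  eval-X^n-1 : ∀ n x → eval (X ^ₚ n R[X].- R[X].1#) x ≈ x ^ n - 1#
  eval-X^n-1 n x = begin
    eval (X ^ₚ n R[X].- R[X].1#) x             ≈⟨ eval-⊕ (X ^ₚ n) _ x ⟩
    eval (X ^ₚ n) x + eval (R[X].- R[X].1#) x  ≈⟨ +-cong (eval-^ X n x) (eval-⊖ R[X].1# x) ⟩
    eval X x ^ n - eval R[X].1# x
      ≈⟨ +-cong (^-congˡ n (eval-X x)) (-‿cong (eval-constant 1# x)) ⟩
    x ^ n - 1#                                 ∎
    where open ≈-Reasoning setoid

  X-cong : ∀ {a b} → a ≈ b → (X- a) ≋ (X- b)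
  X-cong a≈b = ∷-cong (-‿cong a≈b) R[X].refl

  X⊛ : ∀ p → (X ⊛ p) ≋ (0# ∷ p)
  X⊛ p = R[X].trans (0∷-⊛ (1# ∷ []) p) (∷-cong refl (⊛-identityˡ p))

  shift : ℕ → Poly → Poly
  shift n p = replicate n 0# ++ p

  X^⊛ : ∀ n p → (X ^ₚ n ⊛ p) ≋ shift n p
  X^⊛ zero    p = ⊛-identityˡ p
  X^⊛ (suc n) p = begin
    (X ⊛ X ^ₚ n) ⊛ p   ≈⟨ ⊛-assoc X (X ^ₚ n) p ⟩
    X ⊛ (X ^ₚ n ⊛ p)   ≈⟨ X⊛ _ ⟩
    0# ∷ X ^ₚ n ⊛ p    ≈⟨ ∷-cong refl (X^⊛ n p) ⟩
    0# ∷ shift n p     ∎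
    where open ≈-Reasoning ≋-setoid

  coeff-shift : ∀ n p i → coeff (shift n p) (n ℕ.+ i) ≡ coeff p i
  coeff-shift zero    p i = ≡.refl
  coeff-shift (suc n) p i = coeff-shift n p i

  coeff-≥length : ∀ p {i} → length p ℕ.≤ i → coeff p i ≡ 0#
  coeff-≥length []      _         = ≡.refl
  coeff-≥length (a ∷ p) (s≤s p≤i) = coeff-≥length p p≤i

  -- This representative has length m + 2 and last entry 1, which supply the degree and the leading
  -- coefficient.
  X^n-1-list : ∀ m → (X ^ₚ suc m R[X].- R[X].1#) ≋ (- 1# ∷ shift m R[X].1#)
  X^n-1-list m = begin
    X ^ₚ suc m ⊕ (⊖ R[X].1#)                 ≈⟨ ⊕-cong (R[X].*-identityʳ (X ^ₚ suc m)) R[X].refl ⟨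
    X ^ₚ suc m ⊛ R[X].1# ⊕ (⊖ R[X].1#)       ≈⟨ ⊕-cong (X^⊛ (suc m) R[X].1#) R[X].refl ⟩
    (0# + - 1#) ∷ shift m R[X].1# ⊕ []       ≈⟨ ∷-cong (+-identityˡ _) (⊕-identityʳ _) ⟩
    - 1# ∷ shift m R[X].1#                   ∎
    where open ≈-Reasoning ≋-setoid

  -- If (Xⁿ − 1) p = 0, the coefficients of p are n-periodic, hence zero.
  X^n-1-nonZeroDivisor : ∀ m p → (p ⊛ (X ^ₚ suc m R[X].- R[X].1#)) ≋ [] → p ≋ []
  X^n-1-nonZeroDivisor m p e = coeffwise λ i → begin
    coeff p i                       ≈⟨ periodic (length p) i ⟩
    -- Since n ≥ 1, advancing by `length p` periods passes the end of the list.
    coeff p (length p ℕ.* n ℕ.+ i)  ≡⟨ coeff-≥length p (ℕ.m≤n⇒m≤n+o i (ℕ.m≤m*n (length p) n)) ⟩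
    0#                              ∎
    where
    n = suc m
    shift≋ : shift n p ≋ p
    shift≋ = R[X]ₚ.x∙y⁻¹≈ε⇒x≈y _ _ (begin
      shift n p ⊕ (⊖ p)                            ≈⟨ ⊕-cong (X^⊛ n p) R[X].refl ⟨
      (X ^ₚ n ⊛ p) ⊕ (⊖ p)                         ≈⟨ ⊕-cong (⊛-comm p (X ^ₚ n)) (⊖-cong (R[X].*-identityʳ p)) ⟨
      (p ⊛ X ^ₚ n) ⊕ (⊖ (p ⊛ R[X].1#))             ≈⟨ R[X]ₚ.x[y-z]≈xy-xz p _ _ ⟨
      p ⊛ (X ^ₚ n R[X].- R[X].1#)                  ≈⟨ e ⟩
      []                                           ∎)
      where open ≈-Reasoning ≋-setoid
    open ≈-Reasoning setoid
    periodic : ∀ k i → coeff p i ≈ coeff p (k ℕ.* n ℕ.+ i)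
    periodic zero    i = refl
    periodic (suc k) i = begin
      coeff p i                           ≈⟨ periodic k i ⟩
      coeff p (k ℕ.* n ℕ.+ i)             ≡⟨ coeff-shift n p _ ⟨
      coeff (shift n p) (n ℕ.+ (k ℕ.* n ℕ.+ i))   ≈⟨ at shift≋ _ ⟩
      coeff p (n ℕ.+ (k ℕ.* n ℕ.+ i))     ≡⟨ ≡.cong (coeff p) (ℕ.+-assoc n _ i) ⟨
      coeff p (suc k ℕ.* n ℕ.+ i)         ∎

  -- Synthetic division by X - a: the coefficients of the quotient are the Horner values at `a` of
  -- the successive tails of the list.
  quotient : Carrier → Poly → Poly
  quotient a []          = []
  quotient a (x ∷ [])    = []
  quotient a (x ∷ y ∷ p) = eval (y ∷ p) a ∷ quotient a (y ∷ p)

  length-quotient : ∀ a p → length (quotient a p) ≡ length p ∸ 1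
  length-quotient a []          = ≡.refl
  length-quotient a (x ∷ [])    = ≡.refl
  length-quotient a (x ∷ y ∷ p) = ≡.cong suc (length-quotient a (y ∷ p))

  X-⊛ : ∀ a q → ((X- a) ⊛ q) ≋ ((- a · q) ⊕ (0# ∷ q))
  X-⊛ a q = ⊕-congˡ (- a · q) (∷-cong refl (⊛-identityˡ q))

  factor-theorem : ∀ a p → (((X- a) ⊛ quotient a p) ⊕ constant (eval p a)) ≋ p
  factor-theorem a p = R[X].trans (⊕-cong (X-⊛ a (quotient a p)) R[X].refl) (horner p)
    where
    open ≈-Reasoning setoid
    horner : ∀ p → (((- a · quotient a p) ⊕ (0# ∷ quotient a p)) ⊕ constant (eval p a)) ≋ p
    horner []          = R[X].trans (∷-cong (+-identityˡ 0#) R[X].refl) 0∷[]≋[]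
    horner (x ∷ [])    = ∷-cong (trans (+-identityˡ _) (eval-constant x a)) R[X].refl
    horner (x ∷ y ∷ p) = ∷-cong
      (begin
        (- a * e + 0#) + (x + a * e)    ≈⟨ +-congʳ (+-identityʳ _) ⟩
        - a * e + (x + a * e)           ≈⟨ +-congˡ (+-comm x _) ⟩
        - a * e + (a * e + x)           ≈⟨ +-assoc _ _ x ⟨
        (- a * e + a * e) + x           ≈⟨ +-congʳ (distribʳ e (- a) a) ⟨
        (- a + a) * e + x               ≈⟨ +-congʳ (*-congʳ (-‿inverseˡ a)) ⟩
        0# * e + x                      ≈⟨ +-congʳ (zeroˡ e) ⟩
        0# + x                          ≈⟨ +-identityˡ x ⟩
        x                               ∎)
      (step (quotient a (y ∷ p)) (horner (y ∷ p)))
      where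
      e = eval (y ∷ p) a
      -- The remainder `e` of the tail becomes the constant term of the new quotient, so it moves
      -- from the remainder into the shifted copy of `q`.
      step : ∀ q → (((- a · q) ⊕ (0# ∷ q)) ⊕ constant e) ≋ (y ∷ p) →
             (((- a · q) ⊕ (e ∷ q)) ⊕ []) ≋ (y ∷ p)
      step q ih = R[X].trans (⊕-identityʳ _) (R[X].trans
        (⊕-congˡ (- a · q) (∷-cong (sym (+-identityˡ e)) (R[X].sym (⊕-identityʳ q))))
        (R[X].trans (R[X].sym (⊕-assoc (- a · q) (0# ∷ q) (constant e))) ih))

  root⇒X-∣ : ∀ {a p} → eval p a ≈ 0# → p ≋ ((X- a) ⊛ quotient a p)
  root⇒X-∣ {a} {p} pa≈0 = begin
    p                                            ≈⟨ factor-theorem a p ⟨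
    ((X- a) ⊛ quotient a p) ⊕ constant (eval p a)
      ≈⟨ ⊕-congˡ ((X- a) ⊛ quotient a p) (R[X].trans (∷-cong pa≈0 R[X].refl) 0∷[]≋[]) ⟩
    ((X- a) ⊛ quotient a p) ⊕ []                 ≈⟨ ⊕-identityʳ _ ⟩
    (X- a) ⊛ quotient a p                        ∎
    where open ≈-Reasoning ≋-setoid

  -- Together with the converse below, this reduces congruence modulo Φ in F[C][B] to divisibility
  -- of single coefficients in F[C].
  constant-∣⇒ : ∀ r {p} → constant r ∣ₚ p → ∀ i → r ∣ coeff p i
  constant-∣⇒ r {p} (k ∣ₚ, e) i = coeff k i ∣, (begin
    coeff k i * r                          ≈⟨ *-comm _ r ⟩
    r * coeff k i                          ≈⟨ coeff-· r k i ⟨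
    coeff (r · k) i                        ≈⟨ at constant⊛ i ⟨
    coeff (constant r ⊛ k) i               ≈⟨ at (⊛-comm (constant r) k) i ⟩
    coeff (k ⊛ constant r) i               ≈⟨ at e i ⟩
    coeff p i                              ∎)
    where
    open ≈-Reasoning setoid
    constant⊛ : (constant r ⊛ k) ≋ (r · k)
    constant⊛ = R[X].trans (⊕-congˡ (r · k) 0∷[]≋[]) (⊕-identityʳ _)

  constant-∣⇐ : ∀ r p → (∀ i → r ∣ coeff p i) → constant r ∣ₚ p
  constant-∣⇐ r []      _   = [] ∣ₚ, R[X].refl
  constant-∣⇐ r (a ∷ p) r∣p with r∣p 0 | constant-∣⇐ r p (r∣p ∘ suc)
  ... | k ∣, kr≈a | q ∣ₚ, qr≈p = (k ∷ q) ∣ₚ, ∷-cong (trans (+-identityʳ _) kr≈a) qr≈p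

-- Roots of polynomials over a domain

NoZeroDivisors : ∀ {c ℓ} → CommutativeRing c ℓ → Set (c ⊔ ℓ)
NoZeroDivisors R = ∀ {x y} → x * y ≈ 0# → x ≈ 0# ⊎ y ≈ 0#
  where open CommutativeRing R

module PolynomialsOverDomains
  {c ℓ : Level} (R : CommutativeRing c ℓ) (noZeroDivisors : NoZeroDivisors R) where

  open CommutativeRing R
  open Polynomial R
  open PolynomialProperties R
  open RingProperties ring using (x∙y⁻¹≈ε⇒x≈y)
  open Unique setoid using (Unique)

  private
    R[X] = R [X]
    module R[X] = CommutativeRing R[X]
    module R[X]∙ = CommutativeSemigroupProperties R[X].*-commutativeSemigroup

  -- Roots are split off one by one: at a further root b the factor b - a is nonzero, so the
  -- quotient vanishes there. The length of the cofactor is recorded as a substitute for its degree.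
  split-roots : ∀ {as p} → Unique as → All (λ a → eval p a ≈ 0#) as →
                ∃[ k ] p ≋ (k ⊛ product R[X] (map X-_ as)) × length k ≡ length p ∸ length as
  split-roots {[]}     {p} _ _ = p , R[X].sym (R[X].*-identityʳ p) , ≡.refl
  split-roots {a ∷ as} {p} (a≉as ∷ uniq) (pa≈0 ∷ pas≈0) =
    let k , q≋ , |k| = split-roots uniq (All.zipWith (λ (a≉b , pb≈0) → q-root a≉b pb≈0) (a≉as , pas≈0))
    in k
     , R[X].trans (root⇒X-∣ pa≈0)
         (R[X].trans (⊛-congˡ (X- a) q≋) (R[X]∙.x∙yz≈y∙xz (X- a) k _))
     , ≡.trans |k| (≡.trans (≡.cong (_∸ length as) (length-quotient a p))
                            (ℕ.∸-+-assoc (length p) 1 (length as)))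
    where
    q = quotient a p
    q-root : ∀ {b} → ¬ a ≈ b → eval p b ≈ 0# → eval q b ≈ 0#
    q-root {b} a≉b pb≈0 with noZeroDivisors (begin
      (b - a) * eval q b        ≈⟨ *-congʳ (eval-X- a b) ⟨
      eval (X- a) b * eval q b  ≈⟨ eval-⊛ (X- a) q b ⟨
      eval ((X- a) ⊛ q) b       ≈⟨ eval-cong (root⇒X-∣ {a} {p} pa≈0) b ⟨
      eval p b                  ≈⟨ pb≈0 ⟩
      0#                        ∎)
      where open ≈-Reasoning setoid
    ... | inj₁ b-a≈0 = contradiction (sym (x∙y⁻¹≈ε⇒x≈y b a b-a≈0)) a≉b
    ... | inj₂ qb≈0  = qb≈0

  product≈0⇒ : ∀ {xs} → ¬ 1# ≈ 0# → product R xs ≈ 0# → Any.Any (_≈ 0#) xs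
  product≈0⇒ {[]}     1≉0 e = contradiction e 1≉0
  product≈0⇒ {x ∷ xs} 1≉0 e with noZeroDivisors e
  ... | inj₁ x≈0  = here x≈0
  ... | inj₂ xs≈0 = there (product≈0⇒ 1≉0 xs≈0)

-- Products over lists and lists of divisors

product≈0⇐ : ∀ {c ℓ : Level} (R : CommutativeRing c ℓ) → let open CommutativeRing R in
             ∀ {xs} → Any.Any (_≈ 0#) xs → product R xs ≈ 0#
product≈0⇐ R (here x≈0)        = trans (*-congʳ x≈0) (zeroˡ _)
  where open CommutativeRing R
product≈0⇐ R (there x∈)        = trans (*-congˡ (product≈0⇐ R x∈)) (zeroʳ _)
  where open CommutativeRing R

product-++ : ∀ {c ℓ : Level} (R : CommutativeRing c ℓ) → let open CommutativeRing R in
             ∀ xs ys → product R (xs ++ ys) ≈ product R xs * product R ys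
product-++ R []       ys = sym (*-identityˡ _)
  where open CommutativeRing R
product-++ R (x ∷ xs) ys = trans (*-congˡ (product-++ R xs ys)) (sym (*-assoc x _ _))
  where open CommutativeRing R

product-↭ : ∀ {c ℓ : Level} (R : CommutativeRing c ℓ) → let open CommutativeRing R in
            ∀ {xs ys} → Permutation._↭_ setoid xs ys → product R xs ≈ product R ys
product-↭ R = ↭ₛ.foldr-commMonoid setoid *-isCommutativeMonoid
  where open CommutativeRing R

-- The filter of `divisors` on a range stopped before n, so that `divisors n` is literally this list
-- followed by n and the factor Φ_n splits off the product.
properDivisors : ℕ → List ℕ
properDivisors n = filter (_∣ℕ? n) (map suc (upTo (n ∸ 1)))

divisors-∷ʳ : ∀ m → divisors (suc m) ≡ properDivisors (suc m) ∷ʳ suc m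
divisors-∷ʳ m = begin
  filter ∣n? (map suc (upTo (suc m)))               ≡⟨ ≡.cong (filter ∣n? ∘ map suc) (upTo-∷ʳ m) ⟨
  filter ∣n? (map suc (upTo m ∷ʳ m))                ≡⟨ ≡.cong (filter ∣n?) (map-++ suc (upTo m) [ m ]) ⟩
  filter ∣n? (map suc (upTo m) ∷ʳ suc m)            ≡⟨ filter-++ ∣n? (map suc (upTo m)) [ suc m ] ⟩
  properDivisors (suc m) ++ filter ∣n? [ suc m ]
    ≡⟨ ≡.cong (properDivisors (suc m) ++_) (filter-accept ∣n? ∣ℕ.∣-refl) ⟩
  properDivisors (suc m) ∷ʳ suc m                   ∎
  where
  open ≡.≡-Reasoning
  ∣n? = _∣ℕ? suc m

∈-properDivisors⁺ : ∀ {d n} → 1 ℕ.≤ d → d ℕ.< n → d ∣ℕ n → d ∈ℕ properDivisors n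
∈-properDivisors⁺ {suc d} {suc n} _ (s≤s d<n) d∣n =
  ∈ₚ.∈-filter⁺ (_∣ℕ? suc n) (∈ₚ.∈-map⁺ suc (∈ₚ.∈-upTo⁺ d<n)) d∣n

∈-properDivisors⁻ : ∀ {d n} → d ∈ℕ properDivisors n → 1 ℕ.≤ d × d ℕ.< n × d ∣ℕ n
∈-properDivisors⁻ {d} {suc n} d∈ with ∈ₚ.∈-filter⁻ (_∣ℕ? suc n) {xs = map suc (upTo n)} d∈
... | d∈map , d∣n with ∈ₚ.∈-map⁻ suc d∈map
...   | _ , d∈upTo , ≡.refl = s≤s z≤n , s≤s (∈ₚ.∈-upTo⁻ d∈upTo) , d∣n

∈-divisors⁻ : ∀ {d n} → d ∈ℕ divisors n → 1 ℕ.≤ d × d ∣ℕ n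
∈-divisors⁻ {d} {n} d∈ with ∈ₚ.∈-filter⁻ (_∣ℕ? n) {xs = map suc (upTo n)} d∈
... | d∈map , d∣n with ∈ₚ.∈-map⁻ suc d∈map
...   | _ , _ , ≡.refl = s≤s z≤n , d∣n

-- Change of coefficients and polynomials over a quotient ring

module PolynomialMap
  {c ℓ c′ ℓ′ : Level} (R : CommutativeRing c ℓ) (S : CommutativeRing c′ ℓ′)
  (φ : CommutativeRing.Carrier R → CommutativeRing.Carrier S)
  (φ-homo : RingMorphisms.IsRingHomomorphism
              (CommutativeRing.rawRing R) (CommutativeRing.rawRing S) φ) where

  private
    module R = CommutativeRing R
    module S = CommutativeRing S
    module R[X] = Polynomial R
    module S[X] = Polynomial S
    module S[X]ᵣ = CommutativeRing (S [X])
  open RingMorphisms.IsRingHomomorphism φ-homo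

  coeff-map : ∀ p i → S[X].coeff (map φ p) i S.≈ φ (R[X].coeff p i)
  coeff-map []      i       = S.sym 0#-homo
  coeff-map (a ∷ p) zero    = S.refl
  coeff-map (a ∷ p) (suc i) = coeff-map p i

  map-⊕ : ∀ p q → map φ (p R[X].⊕ q) S[X].≋ (map φ p S[X].⊕ map φ q)
  map-⊕ []      q       = S[X]ᵣ.refl
  map-⊕ (a ∷ p) []      = S[X]ᵣ.refl
  map-⊕ (a ∷ p) (b ∷ q) = S[X].∷-cong (+-homo a b) (map-⊕ p q)

  map-⊖ : ∀ p → map φ (R[X].⊖ p) S[X].≋ (S[X].⊖ map φ p)
  map-⊖ []      = S[X]ᵣ.refl
  map-⊖ (a ∷ p) = S[X].∷-cong (-‿homo a) (map-⊖ p)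

  map-· : ∀ a p → map φ (a R[X].· p) S[X].≋ (φ a S[X].· map φ p)
  map-· a []      = S[X]ᵣ.refl
  map-· a (b ∷ p) = S[X].∷-cong (*-homo a b) (map-· a p)

  map-⊛ : ∀ p q → map φ (p R[X].⊛ q) S[X].≋ (map φ p S[X].⊛ map φ q)
  map-⊛ []      q = S[X]ᵣ.refl
  map-⊛ (a ∷ p) q = S[X]ᵣ.trans (map-⊕ (a R[X].· q) _)
    (S[X].⊕-cong (map-· a q) (S[X].∷-cong 0#-homo (map-⊛ p q)))

module PolynomialQuotient
  {c ℓ : Level} (R : CommutativeRing c ℓ) (f : CommutativeRing.Carrier R) where

  open CommutativeRing R
  open Polynomial R using (coeff; at; constant; coeff-⊕; coeff-⊖)
  open PolynomialProperties R
  open Divisibility semiring using (_∣_; _∣0; ∣-respʳ)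
  open RingProperties ring using (x≈y⇒x∙y⁻¹≈ε)

  private
    R[X] = R [X]
    R/f  = R /⟨ f ⟩
    module R[X] = CommutativeRing R[X]
    module R/f = CommutativeRing R/f
    module R[X]/f = CommutativeRing (R[X] /⟨ constant f ⟩)
    module R/f[X] = CommutativeRing (R/f [X])
    module Q = Polynomial R/f

  ≈⇒≈/ : ∀ {x y} → x ≈ y → x R/f.≈ y
  ≈⇒≈/ x≈y = ∣-respʳ (sym (x≈y⇒x∙y⁻¹≈ε x≈y)) (f ∣0)

  id-isRingHomomorphism : RingMorphisms.IsRingHomomorphism rawRing R/f.rawRing id
  id-isRingHomomorphism = record
    { isSemiringHomomorphism = record
      { isNearSemiringHomomorphism = record
        { +-isMonoidHomomorphism = record
          { isMagmaHomomorphism = record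
            { isRelHomomorphism = record { cong = ≈⇒≈/ }
            ; homo = λ x y → R/f.refl
            }
          ; ε-homo = R/f.refl
          }
        ; *-homo = λ x y → R/f.refl
        }
      ; 1#-homo = R/f.refl
      }
    ; -‿homo = λ x → R/f.refl
    }

  open PolynomialMap R R/f id id-isRingHomomorphism

  private
    coeff-minus : ∀ p q i → coeff (p R[X].- q) i ≈ coeff p i - coeff q i
    coeff-minus p q i = trans (coeff-⊕ p _ i) (+-congˡ (coeff-⊖ q i))

  ≈/⇒map≋ : ∀ {p q} → p R[X]/f.≈ q → map id p R/f[X].≈ map id q
  ≈/⇒map≋ {p} {q} f∣p-q = Q.coeffwise λ i →
    R/f.trans (coeff-map p i) (R/f.trans
      (∣-respʳ (coeff-minus p q i) (constant-∣⇒ f f∣p-q i))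
      (R/f.sym (coeff-map q i)))

  coeffwise-≈/ : ∀ {p q} → (∀ i → f ∣ (coeff p i - coeff q i)) → p R[X]/f.≈ q
  coeffwise-≈/ {p} {q} h = constant-∣⇐ f (p R[X].- q) λ i → ∣-respʳ (sym (coeff-minus p q i)) (h i)

  map≋⇒≈/ : ∀ {p q} → map id p R/f[X].≈ map id q → p R[X]/f.≈ q
  map≋⇒≈/ {p} {q} e = coeffwise-≈/ {p} {q} λ i →
    R/f.trans (R/f.sym (coeff-map p i)) (R/f.trans (Q.at e i) (coeff-map q i))

  -- Both rings have the same lists as elements. Their equalities agree as well: `constant f`
  -- divides p - q exactly when `f` divides each coefficient of p - q.
  map-isRingIsomorphism : RingMorphisms.IsRingIsomorphism R[X]/f.rawRing R/f[X].rawRing (map id)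
  map-isRingIsomorphism = record
    { isRingMonomorphism = record
      { isRingHomomorphism = record
        { isSemiringHomomorphism = record
          { isNearSemiringHomomorphism = record
            { +-isMonoidHomomorphism = record
              { isMagmaHomomorphism = record
                { isRelHomomorphism = record { cong = ≈/⇒map≋ }
                ; homo = map-⊕
                }
              ; ε-homo = R/f[X].refl
              }
            ; *-homo = map-⊛
            }
          ; 1#-homo = R/f[X].refl
          }
        ; -‿homo = map-⊖
        }
      ; injective = map≋⇒≈/
      }
    ; surjective = λ p → p , λ {q} q≈p →
        R/f[X].trans (≈/⇒map≋ q≈p) (R/f[X].reflexive (map-id p))
    }

-- Regular functions given by ring elements

module RegularFunctions {c ℓ : Level} (R : CommutativeRing c ℓ) where

  open CommutativeRing R
  open Spec R
  open PrimeIdeal using (1∉𝔭)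

  regular-cong : ∀ {r s} → r ≈ s → regular r ≈ᵣ regular s
  regular-cong r≈s 𝔭 = 1# , 1∉𝔭 𝔭 , *-congˡ (*-congʳ r≈s)

-- The multiplicative group of a finite field

module FiniteFieldProperties {c ℓ : Level} {q : ℕ} (F : FiniteField c ℓ q) where

  open FiniteField F
  open Membership setoid using (_∈_)
  open Unique setoid using (Unique)
  open Permutation setoid using (_↭_)
  open UniqueLists setoid
  open Inverse enumeration using (to; from; strictlyInverseˡ)
  open Exponentiation semiring using (^-homo-*; ^-congʳ)
  open CommutativeSemigroupProperties *-commutativeSemigroup using (interchange)
  open RingProperties ring using (x∙y⁻¹≈ε⇒x≈y; x≈y⇒x∙y⁻¹≈ε; x[y-z]≈xy-xz)

  -- Comparing indices in the enumeration decides equality; this makes the later case distinctions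
  -- and the search for an exponent constructive.
  _≟_ : ∀ x y → Dec (x ≈ y)
  _≟_ = via-injection (Inverseₚ.Inverse⇒Injection (Inverseₚ.sym enumeration)) Fin._≟_

  noZeroDivisors : NoZeroDivisors commutativeRing
  noZeroDivisors {x} {y} xy≈0 with x ≟ 0#
  ... | yes x≈0 = inj₁ x≈0
  ... | no  x≉0 = let z , xz≈1 = invertible x x≉0 in inj₂ (begin
    y            ≈⟨ *-identityˡ y ⟨
    1# * y       ≈⟨ *-congʳ (trans (*-comm z x) xz≈1) ⟨
    (z * x) * y  ≈⟨ *-assoc z x y ⟩
    z * (x * y)  ≈⟨ *-congˡ xy≈0 ⟩
    z * 0#       ≈⟨ zeroʳ z ⟩
    0#           ∎)
    where open ≈-Reasoning setoid

  *-cancelˡ : ∀ {x y z} → ¬ x ≈ 0# → x * y ≈ x * z → y ≈ z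
  *-cancelˡ {x} {y} {z} x≉0 xy≈xz
    with noZeroDivisors (trans (x[y-z]≈xy-xz x y z) (x≈y⇒x∙y⁻¹≈ε xy≈xz))
  ... | inj₁ x≈0   = contradiction x≈0 x≉0
  ... | inj₂ y-z≈0 = x∙y⁻¹≈ε⇒x≈y y z y-z≈0

  *-≉0 : ∀ {x y} → ¬ x ≈ 0# → ¬ y ≈ 0# → ¬ x * y ≈ 0#
  *-≉0 x≉0 y≉0 xy≈0 with noZeroDivisors xy≈0
  ... | inj₁ x≈0 = x≉0 x≈0
  ... | inj₂ y≈0 = y≉0 y≈0

  ^-≉0 : ∀ {x} n → ¬ x ≈ 0# → ¬ x ^ n ≈ 0#
  ^-≉0 zero    x≉0 = 1≉0
  ^-≉0 (suc n) x≉0 = *-≉0 x≉0 (^-≉0 n x≉0)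

  open PolynomialsOverDomains commutativeRing noZeroDivisors

  nonzeros : List Carrier
  nonzeros = filter (λ x → ¬? (x ≟ 0#)) (tabulate to)

  private
    ≉0-resp : ∀ {x y} → x ≈ y → ¬ x ≈ 0# → ¬ y ≈ 0#
    ≉0-resp x≈y x≉0 y≈0 = x≉0 (trans x≈y y≈0)

    tabulate-unique : Unique (tabulate to)
    tabulate-unique = Uniqueₛ.tabulate⁺ setoid
      (Inverseₚ.Inverse⇒Injection enumeration .Injection.injective)

    ∈-tabulate : ∀ x → x ∈ tabulate to
    ∈-tabulate x = ∈ₛ.∈-resp-≈ setoid (strictlyInverseˡ x) (∈ₛ.∈-tabulate⁺ setoid (from x))

  nonzeros-unique : Unique nonzeros
  nonzeros-unique = Uniqueₛ.filter⁺ setoid _ tabulate-unique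

  ∈-nonzeros⁺ : ∀ {x} → ¬ x ≈ 0# → x ∈ nonzeros
  ∈-nonzeros⁺ x≉0 = ∈ₛ.∈-filter⁺ setoid _ ≉0-resp (∈-tabulate _) x≉0

  ∈-nonzeros⁻ : ∀ {x} → x ∈ nonzeros → ¬ x ≈ 0#
  ∈-nonzeros⁻ = proj₂ ∘ ∈ₛ.∈-filter⁻ setoid _ ≉0-resp {xs = tabulate to}

  length-nonzeros : length nonzeros ≡ q ∸ 1
  length-nonzeros = ≡.cong (_∸ 1) (≡.trans (↭ₛ.xs↭ys⇒|xs|≡|ys| setoid 0∷nonzeros↭) (length-tabulate to))
    where
    0∷nonzeros↭ : 0# ∷ nonzeros ↭ tabulate to
    0∷nonzeros↭ = unique-⊆-⊇⇒↭
      (∈ₛ.∉⇒All[≉] setoid (λ 0∈ → ∈-nonzeros⁻ 0∈ refl) ∷ nonzeros-unique)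
      tabulate-unique (λ _ → ∈-tabulate _) λ {x} _ → case x
      where
      case : ∀ x → x ∈ 0# ∷ nonzeros
      case x with x ≟ 0#
      ... | yes x≈0 = here x≈0
      ... | no  x≉0 = there (∈-nonzeros⁺ x≉0)

  product-map-* : ∀ x ys → product commutativeRing (map (x *_) ys) ≈
                           x ^ length ys * product commutativeRing ys
  product-map-* x []       = sym (*-identityˡ 1#)
  product-map-* x (y ∷ ys) = trans (*-congˡ (product-map-* x ys)) (interchange x y _ _)

  -- Multiplication by x permutes the nonzero elements, so their product ∏ equals x^(q-1) ∏, and ∏ ≠
  -- 0 cancels.
  fermat : ∀ {x} → ¬ x ≈ 0# → x ^ (q ∸ 1) ≈ 1#
  fermat {x} x≉0 = *-cancelˡ ∏≉0 (begin
    ∏ * x ^ (q ∸ 1)                             ≈⟨ *-comm ∏ _ ⟩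
    x ^ (q ∸ 1) * ∏                             ≡⟨ ≡.cong (λ n → x ^ n * ∏) length-nonzeros ⟨
    x ^ length nonzeros * ∏                     ≈⟨ product-map-* x nonzeros ⟨
    product commutativeRing (map (x *_) nonzeros)   ≈⟨ product-↭ commutativeRing map↭ ⟩
    ∏                                           ≈⟨ *-identityʳ ∏ ⟨
    ∏ * 1#                                      ∎)
    where
    open ≈-Reasoning setoid
    ∏ = product commutativeRing nonzeros
    ∏≉0 : ¬ ∏ ≈ 0#
    ∏≉0 ∏≈0 = let y , y∈ , y≈0 = Membership.find setoid (product≈0⇒ 1≉0 ∏≈0) in ∈-nonzeros⁻ y∈ y≈0
    map↭ : map (x *_) nonzeros ↭ nonzeros
    map↭ = unique-⊆-length⇒↭
      (Uniqueₛ.map⁺ setoid setoid (*-cancelˡ x≉0) nonzeros-unique)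
      (λ y∈ → let z , z∈ , y≈xz = ∈ₛ.∈-map⁻ setoid setoid y∈ in
        ∈-nonzeros⁺ (≉0-resp (sym y≈xz) (*-≉0 x≉0 (∈-nonzeros⁻ z∈))))
      (≡.sym (length-map (x *_) nonzeros))

  ^-multiple : ∀ {x e} k → x ^ e ≈ 1# → x ^ (k ℕ.* e) ≈ 1#
  ^-multiple         zero    _ = refl
  ^-multiple {x} {e} (suc k) h =
    trans (^-homo-* x e (k ℕ.* e)) (trans (*-cong h (^-multiple k h)) (*-identityˡ 1#))

  ^-cancel-multiple : ∀ x d {e} k → x ^ e ≈ 1# → x ^ (d ℕ.+ k ℕ.* e) ≈ 1# → x ^ d ≈ 1#
  ^-cancel-multiple x d {e} k h h′ = begin
    x ^ d                   ≈⟨ *-identityʳ _ ⟨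
    x ^ d * 1#              ≈⟨ *-congˡ (^-multiple k h) ⟨
    x ^ d * x ^ (k ℕ.* e)   ≈⟨ ^-homo-* x d (k ℕ.* e) ⟨
    x ^ (d ℕ.+ k ℕ.* e)     ≈⟨ h′ ⟩
    1#                      ∎
    where open ≈-Reasoning setoid

  -- Bézout over ℕ puts one multiple on the side of the gcd, as in gcd + v n = u m, which avoids
  -- negative exponents.
  ^-gcd : ∀ {x} m n → x ^ m ≈ 1# → x ^ n ≈ 1# → x ^ gcd m n ≈ 1#
  ^-gcd {x} m n x^m≈1 x^n≈1 with Bézout.identity (gcd-GCD m n)
  ... | Bézout.+- u v eq = ^-cancel-multiple x (gcd m n) {n} v x^n≈1 (trans (^-congʳ x eq) (^-multiple {x} {m} u x^m≈1))
  ... | Bézout.-+ u v eq = ^-cancel-multiple x (gcd m n) {m} u x^m≈1 (trans (^-congʳ x eq) (^-multiple {x} {n} v x^n≈1))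

  -- The proper divisors are searched for an exponent d. If there is none, the powers below n = q -
  -- 1 are distinct: x^i = x^j with i < j gives x^(j-i) = 1, and with x^n = 1 the exponent gcd(j -
  -- i, n) would be such a divisor. These n powers then exhaust the n nonzero elements.
  primitive-or-^≈1 : ∀ {x} → ¬ x ≈ 0# →
    IsPrimitiveElement x ⊎ (∃[ d ] d ∈ℕ properDivisors (q ∸ 1) × x ^ d ≈ 1#)
  primitive-or-^≈1 {x} x≉0 with Any.any? (λ d → (x ^ d) ≟ 1#) (properDivisors (q ∸ 1))
  ... | yes d∈ = inj₂ (find d∈)
  ... | no  ¬∃ = inj₁ (x≉0 , λ a a≉0 →
    let i , _ , a≈x^i = ∈ₛ.∈-applyUpTo⁻ setoid (x ^_)
                          (↭ₛ.∈-resp-↭ setoid (Permutation.↭-sym setoid powers↭) (∈-nonzeros⁺ a≉0))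
    in i , sym a≈x^i)
    where
    n = q ∸ 1
    distinct : ∀ {i j} → i ℕ.< j → j ℕ.< n → ¬ x ^ i ≈ x ^ j
    distinct {i} {j} i<j j<n x^i≈x^j = ¬∃ (lose
      (∈-properDivisors⁺ (ℕ.n≢0⇒n>0 d≢0) (ℕ.≤-<-trans (∣ℕ.∣⇒≤ {{ℕ.>-nonZero e>0}} (gcd[m,n]∣m e n)) e<n) (gcd[m,n]∣n e n))
      (^-gcd e n x^e≈1 (fermat x≉0)))
      where
      e = j ∸ i
      e>0 : 0 ℕ.< e
      e>0 = ℕ.m<n⇒0<n∸m i<j
      e<n : e ℕ.< n
      e<n = ℕ.≤-<-trans (ℕ.m∸n≤m j i) j<n
      d≢0 : ¬ gcd e n ≡ 0
      d≢0 d≡0 = ℕ.m>n⇒m∸n≢0 i<j (gcd[m,n]≡0⇒m≡0 d≡0)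
      x^e≈1 : x ^ e ≈ 1#
      x^e≈1 = *-cancelˡ (^-≉0 i x≉0) (begin
        x ^ i * x ^ e    ≈⟨ ^-homo-* x i e ⟨
        x ^ (i ℕ.+ e)    ≡⟨ ≡.cong (x ^_) (ℕ.m+[n∸m]≡n (ℕ.<⇒≤ i<j)) ⟩
        x ^ j            ≈⟨ x^i≈x^j ⟨
        x ^ i            ≈⟨ *-identityʳ _ ⟨
        x ^ i * 1#       ∎)
        where open ≈-Reasoning setoid
    powers↭ : applyUpTo (x ^_) n ↭ nonzeros
    powers↭ = unique-⊆-length⇒↭ (Uniqueₛ.applyUpTo⁺₁ setoid (x ^_) n distinct)
      (λ y∈ → let i , _ , y≈x^i = ∈ₛ.∈-applyUpTo⁻ setoid (x ^_) y∈ in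
        ∈-nonzeros⁺ (≉0-resp (sym y≈x^i) (^-≉0 i x≉0)))
      (≡.trans length-nonzeros (≡.sym (length-applyUpTo (x ^_) n)))

  -- Divisibility by the cyclotomic polynomial

  private
    F[X] = commutativeRing [X]
    module F[X] = CommutativeRing F[X]
    module F[X]ₚ = RingProperties F[X].ring
    open Polynomial commutativeRing
    open PolynomialProperties commutativeRing
    open Exponentiation F[X].semiring using () renaming (_^_ to _^ₚ_)
    open Divisibility F[X].semiring using (_∣_) renaming (_,_ to _∣,_)

    X^[_]-1 : ℕ → Poly
    X^[ n ]-1 = X ^ₚ n F[X].- F[X].1#

  q-1>0 : 1 ℕ.≤ q ∸ 1
  q-1>0 = ≡.subst (1 ℕ.≤_) length-nonzeros (∈ₛ.∈-length setoid (∈-nonzeros⁺ 1≉0))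

  -- The degree of Xⁿ − 1 is the number of its roots, so splitting them off leaves a constant.
  X^n-1-splits : ∀ {m as} → Unique as → length as ≡ suc m →
                 All (λ a → eval X^[ suc m ]-1 a ≈ 0#) as →
                 ∃[ a ] X^[ suc m ]-1 ≋ (constant a ⊛ product F[X] (map X-_ as))
  X^n-1-splits {m} {as} uniq |as| roots =
    let u , g≋ , |u| = split-roots {p = g} uniq
          (All.map (λ {a} → trans (eval-cong (F[X].sym (X^n-1-list m)) a)) roots)
    in case u (≡.trans |u| |g|∸|as|) (F[X].trans (X^n-1-list m) g≋)
    where
    g = - 1# ∷ shift m F[X].1#
    -- `g` has m + 2 entries and `as` has m + 1, so exactly one coefficient is left for the
    -- cofactor.
    |g|∸|as| : length g ∸ length as ≡ 1
    |g|∸|as| = ≡.trans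
      (≡.cong₂ (λ i j → suc i ∸ j)
        (≡.trans (length-++ (replicate m 0#)) (≡.cong (ℕ._+ 1) (length-replicate m))) |as|)
      (ℕ.m+n∸m≡n m 1)
    case : ∀ u {p q} → length u ≡ 1 → p ≋ (u ⊛ q) → ∃[ a ] p ≋ (constant a ⊛ q)
    case (a ∷ []) _ e = a , e

  -- Both polynomials are multiples of ∏ (X - a). For X^n - 1 the cofactor is a nonzero constant,
  -- whose inverse turns the factorization of `h` into a multiple of X^n - 1.
  X^n-1-∣ : ∀ {m as h} → Unique as → length as ≡ suc m →
            All (λ a → eval X^[ suc m ]-1 a ≈ 0#) as → All (λ a → eval h a ≈ 0#) as →
            X^[ suc m ]-1 ∣ h
  X^n-1-∣ {m} {as} {h} uniq |as| roots h≈0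
    with X^n-1-splits uniq |as| roots | split-roots {p = h} uniq h≈0
  ... | a , X^n-1≋ | k , h≋ , _ = (k ⊛ constant v) ∣, (begin
    (k ⊛ constant v) ⊛ X^[ suc m ]-1     ≈⟨ ⊛-assoc k (constant v) _ ⟩
    k ⊛ (constant v ⊛ X^[ suc m ]-1)     ≈⟨ ⊛-congˡ k (⊛-congˡ (constant v) X^n-1≋) ⟩
    k ⊛ (constant v ⊛ (constant a ⊛ ∏))  ≈⟨ ⊛-congˡ k (⊛-assoc (constant v) (constant a) ∏) ⟨
    k ⊛ ((constant v ⊛ constant a) ⊛ ∏)  ≈⟨ ⊛-congˡ k (⊛-cong va≋1 F[X].refl) ⟩
    k ⊛ (F[X].1# ⊛ ∏)                    ≈⟨ ⊛-congˡ k (⊛-identityˡ ∏) ⟩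
    k ⊛ ∏                                ≈⟨ h≋ ⟨
    h                                    ∎)
    where
    ∏ = product F[X] (map X-_ as)
    a≉0 : ¬ a ≈ 0#
    -- With a = 0 the polynomial X^n - 1 would be zero, but its coefficient at n is 1.
    a≉0 a≈0 = 1≉0 (begin
      1#                                ≡⟨ coeff-shift m F[X].1# 0 ⟨
      coeff (shift m F[X].1#) (m ℕ.+ 0) ≡⟨ ≡.cong (coeff (shift m F[X].1#)) (ℕ.+-identityʳ m) ⟩
      coeff (shift m F[X].1#) m         ≈⟨ at (X^n-1-list m) (suc m) ⟨
      coeff X^[ suc m ]-1 (suc m)       ≈⟨ at X^n-1≋0 (suc m) ⟩
      0#                                ∎)
      where
      open ≈-Reasoning setoid
      X^n-1≋0 : X^[ suc m ]-1 ≋ []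
      X^n-1≋0 = F[X].trans X^n-1≋ (⊛-cong (F[X].trans (∷-cong a≈0 F[X].refl) 0∷[]≋[]) F[X].refl)
    v = proj₁ (invertible a a≉0)
    va≋1 : (constant v ⊛ constant a) ≋ F[X].1#
    va≋1 = ∷-cong (trans (+-identityʳ _) (trans (*-comm v a) (proj₂ (invertible a a≉0)))) F[X].refl
    open ≈-Reasoning ≋-setoid

  cyclotomic-∣ : ∀ {Φ f} → IsCyclotomic F (q ∸ 1) Φ →
                 (∀ c → IsPrimitiveElement c → eval f c ≈ 0#) → Φ ∣ f
  -- The successor form is what `divisors-∷ʳ` and the facts on X^n - 1 require; `n≡` carries over
  -- what was shown for `q ∸ 1`.
  cyclotomic-∣ {Φ₀} {f} (Φ , family , Φ₀≋) f≈0 with q ∸ 1 in n≡ | q-1>0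
  ... | suc m | _ = result X^n-1∣fG
    where
    n = suc m
    G = product F[X] (map Φ (properDivisors n))

    GΦₙ≋ : (G ⊛ Φ n) ≋ X^[ n ]-1
    GΦₙ≋ = begin
      G ⊛ Φ n                                                 ≈⟨ ⊛-congˡ G (F[X].*-identityʳ (Φ n)) ⟨
      G ⊛ product F[X] [ Φ n ]                                ≈⟨ product-++ F[X] (map Φ (properDivisors n)) [ Φ n ] ⟨
      product F[X] (map Φ (properDivisors n) ++ [ Φ n ])      ≡⟨ ≡.cong (product F[X]) (map-++ Φ (properDivisors n) [ n ]) ⟨
      product F[X] (map Φ (properDivisors n ∷ʳ n))            ≡⟨ ≡.cong (product F[X] ∘ map Φ) (divisors-∷ʳ m) ⟨
      product F[X] (map Φ (divisors n))                       ≈⟨ family n (s≤s z≤n) ⟩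
      X^[ n ]-1                                                 ∎
      where open ≈-Reasoning ≋-setoid

    product≈0 : ∀ {ds e} x → e ∈ℕ ds → eval (Φ e) x ≈ 0# → eval (product F[X] (map Φ ds)) x ≈ 0#
    product≈0 {ds} x e∈ h = trans (eval-product (map Φ ds) x)
      (product≈0⇐ commutativeRing (Anyₚ.map⁺ (Anyₚ.map⁺ (lose e∈ h))))

    -- The defining relation is used at d rather than n: a factor Φ_e of C^d - 1 vanishes at x, and
    -- e ≤ d < n makes Φ_e a factor of G.
    G≈0 : ∀ {x d} → d ∈ℕ properDivisors n → x ^ d ≈ 1# → eval G x ≈ 0#
    G≈0 {x} {d} d∈ x^d≈1 =
      let 1≤d , d<n , d∣n = ∈-properDivisors⁻ {n = n} d∈
          e , e∈ , Φₑ≈0 = find (Anyₚ.map⁻ (Anyₚ.map⁻ (product≈0⇒ 1≉0 (begin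
            product commutativeRing (map (λ p → eval p x) (map Φ (divisors d)))
              ≈⟨ eval-product (map Φ (divisors d)) x ⟨
            eval (product F[X] (map Φ (divisors d))) x   ≈⟨ eval-cong (family d 1≤d) x ⟩
            eval (X^[ d ]-1) x                             ≈⟨ eval-X^n-1 d x ⟩
            x ^ d - 1#                                   ≈⟨ x≈y⇒x∙y⁻¹≈ε x^d≈1 ⟩
            0#                                           ∎))))
          1≤e , e∣d = ∈-divisors⁻ e∈
          e≤d = ∣ℕ.∣⇒≤ {{ℕ.>-nonZero 1≤d}} e∣d
      in product≈0 {properDivisors n} x (∈-properDivisors⁺ 1≤e (ℕ.≤-<-trans e≤d d<n) (∣ℕ.∣-trans e∣d d∣n)) Φₑ≈0
      where open ≈-Reasoning setoid

    fG≈0 : ∀ {x} → ¬ x ≈ 0# → eval (f ⊛ G) x ≈ 0#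
    fG≈0 {x} x≉0 with primitive-or-^≈1 x≉0
    ... | inj₁ prim = trans (eval-⊛ f G x) (trans (*-congʳ (f≈0 x prim)) (zeroˡ _))
    ... | inj₂ (d , d∈ , x^d≈1) = trans (eval-⊛ f G x) (trans
      (*-congˡ (G≈0 (≡.subst (λ n → d ∈ℕ properDivisors n) n≡ d∈) x^d≈1)) (zeroʳ _))

    X^n-1∣fG : X^[ n ]-1 ∣ (f ⊛ G)
    X^n-1∣fG = X^n-1-∣ nonzeros-unique (≡.trans length-nonzeros n≡)
      (All.map (λ {x} x≉0 → trans (eval-X^n-1 n x) (x≈y⇒x∙y⁻¹≈ε
                   (≡.subst (λ n → x ^ n ≈ 1#) n≡ (fermat x≉0)))) nonzeros-≉0)
      (All.map fG≈0 nonzeros-≉0)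
      where
      nonzeros-≉0 : All (λ x → ¬ x ≈ 0#) nonzeros
      nonzeros-≉0 = Allₚ.all-filter _ (tabulate to)

    -- The cofactor `k` of X^n - 1 in f G also serves for `f`: the difference r = k Φ₀ - f satisfies
    -- r G = 0, and a further factor Φ_n completes G to X^n - 1, which can be cancelled.
    result : X^[ n ]-1 ∣ (f ⊛ G) → Φ₀ ∣ f
    result (k ∣, e) = k ∣, F[X]ₚ.x∙y⁻¹≈ε⇒x≈y _ _ (X^n-1-nonZeroDivisor m r (begin
      r ⊛ X^[ n ]-1                  ≈⟨ ⊛-congˡ r GΦₙ≋ ⟨
      r ⊛ (G ⊛ Φ n)                ≈⟨ ⊛-assoc r G (Φ n) ⟨
      (r ⊛ G) ⊛ Φ n                ≈⟨ ⊛-cong rG≋0 F[X].refl ⟩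
      []                           ∎))
      where
      open ≈-Reasoning ≋-setoid
      r = k ⊛ Φ₀ F[X].- f
      rG≋0 : (r ⊛ G) ≋ []
      rG≋0 = begin
        r ⊛ G                                ≈⟨ F[X]ₚ.[y-z]x≈yx-zx G (k ⊛ Φ₀) f ⟩
        (k ⊛ Φ₀) ⊛ G F[X].- f ⊛ G            ≈⟨ F[X]ₚ.x≈y⇒x∙y⁻¹≈ε (begin
          (k ⊛ Φ₀) ⊛ G     ≈⟨ ⊛-assoc k Φ₀ G ⟩
          k ⊛ (Φ₀ ⊛ G)     ≈⟨ ⊛-congˡ k (⊛-cong Φ₀≋ F[X].refl) ⟩
          k ⊛ (Φ n ⊛ G)    ≈⟨ ⊛-congˡ k (⊛-comm (Φ n) G) ⟩
          k ⊛ (G ⊛ Φ n)    ≈⟨ ⊛-congˡ k GΦₙ≋ ⟩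
          k ⊛ X^[ n ]-1      ≈⟨ e ⟩
          f ⊛ G            ∎) ⟩
        []                                   ∎

-- Uniqueness modulo Φ and the regular function

open import Data.Nat.Base using (_^_)

theorem5p15 : ∀ {c ℓ c′ ℓ′} (q : ℕ) → IsPrimePower q →
    (F : FiniteField c ℓ q) (E : FiniteField c′ ℓ′ (q ^ 2))
    (ι : FiniteField.Carrier F → FiniteField.Carrier E) →
    RingMorphisms.IsRingHomomorphism (FiniteField.rawRing F) (FiniteField.rawRing E) ι →
    let open Quadratic F E ι in
    (Φ : F[C].Carrier) → IsCyclotomic F (q ∸ 1) Φ →
    let open Modulo Φ in
    (P P′ : F[C][B].Carrier) → IsOptimalDetermining P → IsOptimalDetermining P′ →
    (P ≡ P′ modΦ)
    × (RingMorphisms.IsRingIsomorphism F[C][B]/Φ.rawRing A[B].rawRing image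
    × image P A[B].≈ image P′)
    × ∃! 𝒳._≈ᵣ_ (λ f → ∀ Q → IsOptimalDetermining Q → 𝒳.regular (image Q) 𝒳.≈ᵣ f)
theorem5p15 q _ F E ι _ Φ Φ-cyclotomic P P′ P-opt P′-opt =
    congruent P-opt P′-opt
  , (map-isRingIsomorphism , ≈/⇒map≋ (congruent P-opt P′-opt))
  -- Every optimal Q is congruent to P, so all of them give this function; conversely, a function
  -- with the property agrees with it, as the case Q = P shows.
  , 𝒳.regular (image P)
  , (λ Q Q-opt → regular-cong (≈/⇒map≋ {Q} {P} (congruent Q-opt P-opt)))
  , λ f-unique → f-unique P P-opt
  where
  open Quadratic F E ι
  open Modulo Φ
  module F = FiniteField F
  open FiniteFieldProperties F using (cyclotomic-∣)
  open PolynomialQuotient F[C] Φ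
  open RegularFunctions A[B]
  open Polynomial F.commutativeRing using (coeff; eval; at)
  open Polynomial F[C] using () renaming (coeff to coeffᴮ)
  open PolynomialProperties F.commutativeRing using (X-cong; eval-⊕; eval-⊖)

  -- Past the end of `Q` both sides reduce to 0#, so the equality is propositional.
  coeff-at-C : ∀ Q c i → coeff (Q at-C≔ c) i ≡ eval (coeffᴮ Q i) c
  coeff-at-C []      c i       = ≡.refl
  coeff-at-C (p ∷ Q) c zero    = ≡.refl
  coeff-at-C (p ∷ Q) c (suc i) = coeff-at-C Q c i

  -- The two enumerations may differ in order and in the representatives of their entries, hence a
  -- permutation up to the equality of F.
  at-C≈ : ∀ {Q Q′} → IsOptimalDetermining Q → IsOptimalDetermining Q′ →
          ∀ c → F.IsPrimitiveElement c → (Q at-C≔ c) F[B].≈ (Q′ at-C≔ c)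
  at-C≈ Q-opt Q′-opt c c-prim =
    let bs  , (uniq  , bs⇔)  , Q≈  = Q-opt c c-prim
        bs′ , (uniq′ , bs′⇔) , Q′≈ = Q′-opt c c-prim
        bs↭bs′ = UniqueLists.unique-⊆-⊇⇒↭ F.setoid uniq uniq′
          (λ {b} b∈ → Equivalence.from (bs′⇔ b) (Equivalence.to (bs⇔ b) b∈))
          (λ {b} b∈ → Equivalence.from (bs⇔ b) (Equivalence.to (bs′⇔ b) b∈))
    in F[B].trans Q≈ (F[B].trans
         (product-↭ F[B] (↭ₛ.map⁺ F.setoid F[B].setoid X-cong bs↭bs′))
         (F[B].sym Q′≈))

  congruent : ∀ {Q Q′} → IsOptimalDetermining Q → IsOptimalDetermining Q′ → Q ≡ Q′ modΦ
  congruent {Q} {Q′} Q-opt Q′-opt = coeffwise-≈/ {Q} {Q′} λ i →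
    cyclotomic-∣ {f = coeffᴮ Q i F[C].- coeffᴮ Q′ i} Φ-cyclotomic λ c c-prim → begin
      eval (coeffᴮ Q i F[C].- coeffᴮ Q′ i) c
        ≈⟨ F.trans (eval-⊕ (coeffᴮ Q i) _ c) (F.+-congˡ (eval-⊖ (coeffᴮ Q′ i) c)) ⟩
      eval (coeffᴮ Q i) c F.- eval (coeffᴮ Q′ i) c
        ≡⟨ ≡.cong₂ F._-_ (coeff-at-C Q c i) (coeff-at-C Q′ c i) ⟨
      coeff (Q at-C≔ c) i F.- coeff (Q′ at-C≔ c) i
        ≈⟨ x≈y⇒x∙y⁻¹≈ε (at (at-C≈ Q-opt Q′-opt c c-prim) i) ⟩
      F.0# ∎
    where
    open ≈-Reasoning F.setoid
    open RingProperties F.ring using (x≈y⇒x∙y⁻¹≈ε)
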